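{- Let $G$ be a planar graph and $M$ a maximum matching of $G$. If $x$ is a vertex unmatched in $M$, then there exists a vertex $v\in S(x)$ with $\deg_G(v)\le 5$ (possibly $v=x$).
   Context: Graphs are finite and simple. A vertex is unmatched by a matching $M$ if it is incident to no edge of $M$. An $M$-alternating path is a path whose edges alternate between edges in $M$ and edges not in $M$. For a vertex $x$ unmatched by $M$, a vertex $v$ is switchable from $x$ if there is an $M$-alternating path of even length starting in $x$ with an edge not in $M$ and ending in $v$ with an edge in $M$. $S(x)$ denotes the set consisting of $x$ together with all vertices switchable from $x$ (with respect to $M$). -}

module Defs where

open import Data.Bool.Base using (Bool; true; false; T; _∧_)
open import Data.Fin.Base using (Fin)
open import Data.Fin.Properties using (_<?_)
open import Data.Fin.Subset using (Subset; ∣_∣)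
open import Data.List.Base using (List; []; _∷_; head; last; length; map; allFin)
open import Data.List.Relation.Unary.Linked using (Linked)
open import Data.List.Relation.Unary.Unique.Propositional using (Unique)
open import Data.Maybe.Base using (just)
open import Data.Nat.Base using (ℕ; _+_; _*_; _≤_; _≡ᵇ_)
open import Data.Nat.Divisibility using (_∣_)
open import Data.Nat.ListAction using (sum)
open import Data.Product.Base using (_×_)
open import Data.Sum.Base using (_⊎_)
open import Data.Vec.Base using (tabulate)
open import Function.Bundles using (_⇔_)
open import Function.Definitions using (StrictlySurjective)
open import Level using (0ℓ)
open import Relation.Binary.Core using (Rel)
open import Relation.Binary.Construct.Closure.ReflexiveTransitive using (Star; ε; _◅_)
open import Relation.Binary.PropositionalEquality using (_≡_; _≢_; subst)
open import Relation.Nullary.Decidable.Core using (⌊_⌋)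
open import Relation.Nullary.Negation.Core using (¬_)

record Graph (n : ℕ) : Set where
  field
    adj    : Fin n → Fin n → Bool
    sym    : ∀ u v → adj u v ≡ adj v u
    irrefl : ∀ u → adj u u ≡ false

  Adj : Rel (Fin n) 0ℓ
  Adj u v = T (adj u v)

  neighbours : Fin n → Subset n
  neighbours u = tabulate (adj u)

  deg : Fin n → ℕ
  deg u = ∣ neighbours u ∣

  -- Each edge is counted once, at its smaller endpoint.
  numEdges : ℕ
  numEdges = sum (map (λ u → ∣ tabulate (λ v → adj u v ∧ ⌊ u <? v ⌋) ∣) (allFin n))

  numIsolated : ℕ
  numIsolated = ∣ tabulate (λ u → deg u ≡ᵇ 0) ∣

open Graph public using (Adj; deg; numEdges; numIsolated)

-- The equivalence relation _~_ has exactly k classes.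
record Classes {A : Set} (_~_ : Rel A 0ℓ) (k : ℕ) : Set where
  field
    class      : A → Fin k
    surjective : StrictlySurjective _≡_ class
    class-≡    : ∀ a b → class a ≡ class b ⇔ a ~ b

record Dart {n : ℕ} (G : Graph n) : Set where
  constructor dart
  field
    tail : Fin n
    tip  : Fin n
    edge : Adj G tail tip

open Dart public

reverse : ∀ {n} {G : Graph n} → Dart G → Dart G
reverse {G = G} (dart u v e) = dart v u (subst T (Graph.sym G u v) e)

-- b is reached from a by iterating f; for a permutation of a finite type,
-- "a and b lie on the same cycle".
Orbit : {A : Set} → (A → A) → Rel A 0ℓ
Orbit f = Star (λ a b → f a ≡ b)

-- A cyclic order of the darts leaving each vertex.  That next is a
-- permutation follows from cyclic, as there are finitely many darts.
record RotationSystem {n : ℕ} (G : Graph n) : Set where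
  field
    next      : Dart G → Dart G
    next-tail : ∀ d → tail (next d) ≡ tail d
    cyclic    : ∀ d d′ → tail d ≡ tail d′ → Orbit next d d′

  -- The facial walks of the embedding are the cycles of this permutation.
  faceStep : Dart G → Dart G
  faceStep d = next (reverse d)

-- G is planar: some rotation system embeds every connected component in a
-- sphere.  A component with n′ vertices, m′ edges and f′ faces is embedded in
-- an orientable surface of genus g ≥ 0 with n′ - m′ + f′ = 2 - 2 g; as all
-- genera are non-negative, they all vanish exactly when the sum over the
-- components is n - m + f = 2 c.  An isolated vertex carries no dart, so its
-- single face is counted by numIsolated.
record Planar {n : ℕ} (G : Graph n) : Set where
  field
    rotation      : RotationSystem G
    numFaceCycles : ℕ
    faceCycles    : Classes (Orbit (RotationSystem.faceStep rotation)) numFaceCycles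
    numComponents : ℕ
    components    : Classes (Star (Adj G)) numComponents
    genus-zero    : n + (numFaceCycles + numIsolated G) ≡ numEdges G + 2 * numComponents

-- A matching of G is a set of edges of G, given as a graph M on the same
-- vertices; numEdges M is its size.
record IsMatching {n : ℕ} (G M : Graph n) : Set where
  field
    ⊆-edges  : ∀ u v → Adj M u v → Adj G u v
    disjoint : ∀ u v w → Adj M u v → Adj M u w → v ≡ w

IsMaximumMatching : ∀ {n} → Graph n → Graph n → Set
IsMaximumMatching G M =
  IsMatching G M × (∀ M′ → IsMatching G M′ → numEdges M′ ≤ numEdges M)

Unmatched : ∀ {n} → Graph n → Fin n → Set
Unmatched M x = ∀ v → ¬ Adj M x v

Walk : ∀ {n} → Graph n → Rel (Fin n) 0ℓ
Walk G = Star (Adj G)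

vertices : ∀ {n} {R : Rel (Fin n) 0ℓ} {u v} → Star R u v → List (Fin n)
vertices {u = u} ε       = u ∷ []
vertices {u = u} (_ ◅ p) = u ∷ vertices p

-- Lists, for each edge of the walk in turn, whether it belongs to M.
membership : ∀ {n} {R : Rel (Fin n) 0ℓ} (M : Graph n) {u v} → Star R u v → List Bool
membership M ε                           = []
membership M (_◅_ {i = u} {j = w} _ p) = Graph.adj M u w ∷ membership M p

IsPath : ∀ {n} {R : Rel (Fin n) 0ℓ} {u v} → Star R u v → Set
IsPath p = Unique (vertices p)

Alternating : ∀ {n} {R : Rel (Fin n) 0ℓ} (M : Graph n) {u v} → Star R u v → Set
Alternating M p = Linked _≢_ (membership M p)

record Switchable {n : ℕ} (G M : Graph n) (x v : Fin n) : Set where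
  field
    path        : Walk G x v
    isPath      : IsPath path
    alternating : Alternating M path
    even        : 2 ∣ length (membership M path)
    first∉M     : head (membership M path) ≡ just false
    last∈M      : last (membership M path) ≡ just true

-- v ∈S[ G , M ] x : v belongs to the set S(x).
_∈S[_,_]_ : ∀ {n} → Fin n → (G M : Graph n) → Fin n → Set
v ∈S[ G , M ] x = v ≡ x ⊎ Switchable G M x v

{-# OPTIONS --safe #-}

-- If a matching misses v and v – u is an edge, then exchanging the edge at u
-- for v – u gives a matching of the same size that misses the former partner of
-- u instead.  Let S be the set of vertices missed after some sequence of such
-- rotations that starts with M missing x; then S ⊆ S(x).  Let A be the set of
-- neighbours of S outside S.  As M is maximum, it matches A into S, and its
-- restriction to G[S] is a maximum matching of G[S], which misses x and the
-- partners of A.  Every vertex of S is missed by some maximum matching of G[S],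
-- so by Gallai's lemma each component of G[S] has at most one missed vertex:
-- G[S] has at least |A| + 1 components.  By Euler's formula a planar graph on p
-- vertices with q components has at most 3 (p - q) edges.  If all degrees in S
-- were at least 6, then applying this to G[S] and to the graph of all edges that
-- meet S, which lives on S ∪ A, would give
--   6 |S| ≤ 3 (|S| - |A| - 1) + 3 (|S| + |A| - 1) < 6 |S|.

module Submission where

open import Defs
open import Data.Bool.Base using (Bool; true; false; if_then_else_; T; _∧_)
open import Data.Bool.Properties using (T?; T-irrelevant; T-≡; ∧-identityʳ; ∧-zeroʳ)
open import Data.Empty using (⊥; ⊥-elim)
open import Data.Fin.Base using (Fin; zero; suc; toℕ; punchIn; punchOut; combine;
  funToFin; finToFun)
open import Data.Fin.Permutation.Components using (transpose; transpose-inverse)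
open import Data.Fin.Properties using (_≟_; _<?_; <-asym; <-cmp; all?; any?;
  combine-injective; finToFun-funToFin; pigeonhole; punchInᵢ≢i; punchOut-cong;
  punchOut-punchIn)
import Data.Fin.Subset as Subset
open import Data.List.Base as List using (List; []; _∷_; head; last; length)
open import Data.List.Properties using (map-tabulate)
open import Data.List.Relation.Unary.All as All using (All; []; _∷_)
open import Data.List.Relation.Unary.AllPairs using ([]; _∷_)
open import Data.List.Relation.Unary.Linked using (Linked; []; [-]; _∷_)
open import Data.Maybe.Base using (just)
open import Data.Nat.Base as ℕ using (ℕ; zero; suc; _+_; _*_; _≤_; _<_; _≡ᵇ_; z≤n; s≤s)
open import Data.Nat.Divisibility using (divides)
import Data.Nat.ListAction as Action
open import Data.Nat.Properties using (+-*-semiring; +-0-commutativeMonoid; +-assoc;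
  +-cancelˡ-≤; +-comm; +-identityʳ; +-mono-≤; +-monoʳ-≤; +-monoˡ-≤; +-suc; *-comm;
  *-distribʳ-+; *-distribˡ-+; *-identityʳ; *-monoʳ-≤; <-irrefl; <-≤-trans; _≤?_; m<m+n;
  m≤m+n; m≤n+m; m≤n⇒m≤1+n; n<1+n; n≤1+n; ≡ᵇ⇒≡; ≤-antisym; ≤-refl; ≤-reflexive; ≤-trans;
  ≮⇒≥; ≰⇒>; module ≤-Reasoning)
open import Data.Nat.Tactic.RingSolver using (solve-∀)
open import Data.Product.Base using (_×_; _,_; Σ; ∃; ∃₂; ∃-syntax; proj₁; proj₂)
open import Data.Sum.Base using (_⊎_; inj₁; inj₂)
open import Data.Unit.Base using (tt)
import Data.Vec.Base as Vec
open import Function.Base using (_∘_; id)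
open import Function.Bundles using (Equivalence)
open import Relation.Binary.Construct.Closure.ReflexiveTransitive as Star using (Star;
  ε; _◅_; _◅◅_)
open import Relation.Binary.Definitions using (tri<; tri≈; tri>)
open import Relation.Binary.PropositionalEquality using (_≡_; _≢_; _≗_; refl; sym;
  trans; cong; cong₂; subst; module ≡-Reasoning)
open import Relation.Nullary using (¬_; Dec; yes; no; does; ¬?; _×-dec_; _⊎-dec_;
  _→-dec_; contradiction; ⌊_⌋; map′)
open import Relation.Nullary.Decidable using (dec-true; dec-false; decidable-stable;
  ¬¬-excluded-middle)
import Algebra.Properties.CommutativeMonoid.Sum
import Algebra.Properties.Semiring.Sum
open Algebra.Properties.CommutativeMonoid.Sum +-0-commutativeMonoid
  using (sum; sum-cong-≗; sum-replicate-zero; ∑-comm; ∑-distrib-+)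
open Algebra.Properties.Semiring.Sum +-*-semiring using (*-distribˡ-sum)

-- The two subgraphs get no embedding of their own. The rotation system of `G` is kept, edges are
-- deleted one at a time, and the faces that remain are tracked as labels on the darts of `G`;
-- Euler's formula survives as an inequality, in the direction needed. The bound is 3 (p - q) and
-- not 3 p - 6 q, which already fails for components with one or two vertices. The delicate point is
-- that the restriction of M to G[S] is maximum. Maximality in G does not give this directly, since
-- a larger matching of G[S] may use the partners of A, and the rotations that define S may pass
-- through A. The argument therefore moves along rotations and compares restrictions. Neither
-- connectedness nor reachability by rotations is decided. Both are used only on the way to a
-- contradiction, while the vertex of small degree is found by a search over a decidable property
-- that reachable states satisfy.

private
  variable
    m n : ℕ
    X Y Z : Set

-- Counting decidable predicates

⟦_⟧ : Dec X → ℕ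
⟦ a? ⟧ = if does a? then 1 else 0

⟦⟧-yes : (a? : Dec X) → X → ⟦ a? ⟧ ≡ 1
⟦⟧-yes (yes _) _ = refl
⟦⟧-yes (no ¬a) a = contradiction a ¬a

⟦⟧-no : (a? : Dec X) → ¬ X → ⟦ a? ⟧ ≡ 0
⟦⟧-no (yes a) ¬a = contradiction a ¬a
⟦⟧-no (no _)  _  = refl

⟦⟧-mono : (a? : Dec X) (b? : Dec Y) → (X → Y) → ⟦ a? ⟧ ≤ ⟦ b? ⟧
⟦⟧-mono (no _)  b?      f = z≤n
⟦⟧-mono (yes a) (yes _) f = ≤-refl
⟦⟧-mono (yes a) (no ¬b) f = contradiction (f a) ¬b

⟦⟧-cover : (a? : Dec X) (b? : Dec Y) (c? : Dec Z) → (X → Y ⊎ Z) → ⟦ a? ⟧ ≤ ⟦ b? ⟧ + ⟦ c? ⟧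
⟦⟧-cover (no _)  b?      c?      f = z≤n
⟦⟧-cover (yes a) (yes _) c?      f = s≤s z≤n
⟦⟧-cover (yes a) (no ¬b) (yes _) f = ≤-refl
⟦⟧-cover (yes a) (no ¬b) (no ¬c) f with f a
... | inj₁ b = contradiction b ¬b
... | inj₂ c = contradiction c ¬c

⟦⟧-disjoint : (a? : Dec X) (b? : Dec Y) (c? : Dec Z) →
              (X → Z) → (Y → Z) → (X → ¬ Y) → ⟦ a? ⟧ + ⟦ b? ⟧ ≤ ⟦ c? ⟧
⟦⟧-disjoint (yes a) (yes b) _  _ _ a∦b = contradiction b (a∦b a)
⟦⟧-disjoint (yes a) (no _)  c? f _ _   = ≤-reflexive (sym (⟦⟧-yes c? (f a)))
⟦⟧-disjoint (no _)  (yes b) c? _ g _   = ≤-reflexive (sym (⟦⟧-yes c? (g b)))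
⟦⟧-disjoint (no _)  (no _)  c? _ _ _   = z≤n

sum-mono : (f g : Fin n → ℕ) → (∀ i → f i ≤ g i) → sum f ≤ sum g
sum-mono {zero}  f g f≤g = z≤n
sum-mono {suc n} f g f≤g = +-mono-≤ (f≤g zero) (sum-mono (f ∘ suc) (g ∘ suc) (f≤g ∘ suc))

sum-const : ∀ n k → sum {n} (λ _ → k) ≡ n * k
sum-const zero    k = refl
sum-const (suc n) k = cong (k +_) (sum-const n k)

# : {P : Fin n → Set} → (∀ i → Dec (P i)) → ℕ
# P? = sum (λ i → ⟦ P? i ⟧)

module _ {P Q R : Fin n → Set} (P? : ∀ i → Dec (P i)) (Q? : ∀ i → Dec (Q i)) (R? : ∀ i → Dec (R i)) where

  #-cover : (∀ {i} → P i → Q i ⊎ R i) → # P? ≤ # Q? + # R?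
  #-cover f = ≤-trans
    (sum-mono _ _ (λ i → ⟦⟧-cover (P? i) (Q? i) (R? i) f))
    (≤-reflexive (∑-distrib-+ (λ i → ⟦ Q? i ⟧) (λ i → ⟦ R? i ⟧)))

  #-disjoint : (∀ {i} → P i → R i) → (∀ {i} → Q i → R i) → (∀ {i} → P i → ¬ Q i) →
               # P? + # Q? ≤ # R?
  #-disjoint f g h = ≤-trans
    (≤-reflexive (sym (∑-distrib-+ (λ i → ⟦ P? i ⟧) (λ i → ⟦ Q? i ⟧))))
    (sum-mono _ _ (λ i → ⟦⟧-disjoint (P? i) (Q? i) (R? i) f g h))

#-true : {P : Fin n → Set} (P? : ∀ i → Dec (P i)) → (∀ i → P i) → # P? ≡ n
#-true {n} P? p = begin
  # P?               ≡⟨ sum-cong-≗ (λ i → ⟦⟧-yes (P? i) (p i)) ⟩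
  sum {n} (λ _ → 1)  ≡⟨ sum-const n 1 ⟩
  n * 1              ≡⟨ *-identityʳ n ⟩
  n                  ∎
  where open ≡-Reasoning

#-false : {P : Fin n → Set} (P? : ∀ i → Dec (P i)) → (∀ i → ¬ P i) → # P? ≡ 0
#-false {n} P? ¬p = trans (sum-cong-≗ (λ i → ⟦⟧-no (P? i) (¬p i))) (sum-replicate-zero n)

#-singleton : (i : Fin n) → # (i ≟_) ≡ 1
#-singleton {suc n} zero    = cong suc (#-false {n} (λ j → zero ≟ suc j) (λ _ ()))
#-singleton {suc n} (suc i) =
  trans (sum-cong-≗ (λ j → does-≟-suc i j)) (#-singleton i)
  where
  does-≟-suc : (i j : Fin n) → ⟦ suc i ≟ suc j ⟧ ≡ ⟦ i ≟ j ⟧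
  does-≟-suc i j with i ≟ j
  ... | yes _ = refl
  ... | no _  = refl

module _ {P Q : Fin n → Set} (P? : ∀ i → Dec (P i)) (Q? : ∀ i → Dec (Q i)) where

  #-mono : (∀ {i} → P i → Q i) → # P? ≤ # Q?
  #-mono f = sum-mono _ _ (λ i → ⟦⟧-mono (P? i) (Q? i) f)

  #-insert : ∀ i → (∀ {j} → P j → i ≡ j ⊎ Q j) → # P? ≤ suc (# Q?)
  #-insert i f = ≤-trans (#-cover P? (i ≟_) Q? f) (≤-reflexive (cong (_+ # Q?) (#-singleton i)))

  #-remove : ∀ {i} → (∀ {j} → P j → Q j) → ¬ P i → Q i → suc (# P?) ≤ # Q?
  #-remove {i} f ¬p q = ≤-trans
    (≤-reflexive (cong (_+ # P?) (sym (#-singleton i))))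
    (#-disjoint (i ≟_) P? Q? (λ { refl → q }) f (λ { refl → ¬p }))

#-remove₂ : {P Q : Fin n → Set} (P? : ∀ i → Dec (P i)) (Q? : ∀ i → Dec (Q i)) → ∀ {i j} →
            (∀ {k} → P k → Q k) → ¬ P i → Q i → ¬ P j → Q j → i ≢ j → 2 + # P? ≤ # Q?
#-remove₂ P? Q? {i} {j} f ¬pi qi ¬pj qj i≢j = ≤-trans
  (s≤s (#-remove P? (λ k → (i ≟ k) ⊎-dec P? k) inj₂ ¬pi (inj₁ refl)))
  (#-remove (λ k → (i ≟ k) ⊎-dec P? k) Q? (λ { (inj₁ refl) → qi ; (inj₂ p) → f p })
    (λ { (inj₁ eq) → i≢j eq ; (inj₂ p) → ¬pj p }) qj)

module _ {P : Fin n → Set} (P? : ∀ i → Dec (P i)) where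

  #≤1 : (∀ {i j} → P i → P j → i ≡ j) → # P? ≤ 1
  #≤1 unique with any? P?
  ... | yes (i , p) = ≤-trans (#-mono P? (i ≟_) (λ q → unique p q)) (≤-reflexive (#-singleton i))
  ... | no ¬p       = ≤-trans (≤-reflexive (#-false P? (λ i p → ¬p (i , p)))) z≤n

  #≤⟦⟧ : (a? : Dec X) → (∀ {i} → P i → X) → (∀ {i j} → P i → P j → i ≡ j) → # P? ≤ ⟦ a? ⟧
  #≤⟦⟧ (yes _) f unique = #≤1 unique
  #≤⟦⟧ (no ¬a) f unique = ≤-reflexive (#-false P? (λ _ → ¬a ∘ f))

  #-complement : # P? + # (¬? ∘ P?) ≡ n
  #-complement = begin
    # P? + # (¬? ∘ P?)                         ≡⟨ ∑-distrib-+ (λ i → ⟦ P? i ⟧) _ ⟨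
    sum (λ i → ⟦ P? i ⟧ + ⟦ ¬? (P? i) ⟧)  ≡⟨ sum-cong-≗ (λ i → either (P? i)) ⟩
    sum {n} (λ _ → 1)                          ≡⟨ sum-const n 1 ⟩
    n * 1                                      ≡⟨ *-identityʳ n ⟩
    n                                          ∎
    where
    open ≡-Reasoning
    either : (a? : Dec X) → ⟦ a? ⟧ + ⟦ ¬? a? ⟧ ≡ 1
    either (yes _) = refl
    either (no _)  = refl

-- Each i with P i is counted at f i, so the two sides compare fibre by fibre.
#-injection : {P : Fin m → Set} {Q : Fin n → Set} (P? : ∀ i → Dec (P i)) (Q? : ∀ i → Dec (Q i))
              (f : Fin m → Fin n) → (∀ {i} → P i → Q (f i)) →
              (∀ {i j} → P i → P j → f i ≡ f j → i ≡ j) → # P? ≤ # Q?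
#-injection {m} {n} {P} {Q} P? Q? f into injective = begin
  # P?                                                   ≡⟨ sum-cong-≗ fibres ⟩
  sum (λ i → # (λ k → (f i ≟ k) ×-dec P? i))             ≡⟨ ∑-comm (λ i k → ⟦ (f i ≟ k) ×-dec P? i ⟧) ⟩
  sum (λ k → # (λ i → (f i ≟ k) ×-dec P? i))             ≤⟨ sum-mono _ _ fibre≤ ⟩
  # Q?                                                   ∎
  where
  open ≤-Reasoning
  fibres : ∀ i → ⟦ P? i ⟧ ≡ # (λ k → (f i ≟ k) ×-dec P? i)
  fibres i with P? i
  ... | yes p = sym (trans
    (≤-antisym (#-mono (λ k → (f i ≟ k) ×-dec yes p) (f i ≟_) proj₁)
               (#-mono (f i ≟_) (λ k → (f i ≟ k) ×-dec yes p) (_, p)))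
    (#-singleton (f i)))
  ... | no ¬p = sym (#-false (λ k → (f i ≟ k) ×-dec no ¬p) (λ _ → ¬p ∘ proj₂))
  fibre≤ : ∀ k → # (λ i → (f i ≟ k) ×-dec P? i) ≤ ⟦ Q? k ⟧
  fibre≤ k = #≤⟦⟧ (λ i → (f i ≟ k) ×-dec P? i) (Q? k)
    (λ { (refl , p) → into p })
    (λ { (fi≡k , p) (fj≡k , p′) → injective p p′ (trans fi≡k (sym fj≡k)) })

module _ {E : Fin n → Fin n → Set} where

  ## : (∀ u v → Dec (E u v)) → ℕ
  ## E? = sum (λ u → # (E? u))

module _ {E F : Fin n → Fin n → Set} (E? : ∀ u v → Dec (E u v)) (F? : ∀ u v → Dec (F u v)) where

  ##-mono : (∀ {u v} → E u v → F u v) → ## E? ≤ ## F?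
  ##-mono f = sum-mono _ _ (λ u → #-mono (E? u) (F? u) f)

  ##-remove : ∀ {a b} → (∀ {u v} → E u v → F u v) → ¬ E a b → F a b → suc (## E?) ≤ ## F?
  ##-remove {a} {b} f ¬e e = begin
    suc (## E?)                              ≡⟨ cong (_+ ## E?) (#-singleton a) ⟨
    # (a ≟_) + ## E?                         ≡⟨ ∑-distrib-+ (λ u → ⟦ a ≟ u ⟧) (λ u → # (E? u)) ⟨
    sum (λ u → ⟦ a ≟ u ⟧ + # (E? u))         ≤⟨ sum-mono _ _ row ⟩
    ## F?                                    ∎
    where
    open ≤-Reasoning
    row : ∀ u → ⟦ a ≟ u ⟧ + # (E? u) ≤ # (F? u)
    row u with a ≟ u
    ... | yes refl = #-remove (E? a) (F? a) f ¬e e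
    ... | no _     = #-mono (E? u) (F? u) f

∣tabulate∣≡# : (b : Fin n → _) → Subset.∣ Vec.tabulate b ∣ ≡ # (T? ∘ b)
∣tabulate∣≡# {zero}  b = refl
∣tabulate∣≡# {suc n} b with b zero
... | true  = cong suc (∣tabulate∣≡# (b ∘ suc))
... | false = ∣tabulate∣≡# (b ∘ suc)

sum-allFin : (f : Fin n → ℕ) → Action.sum (List.map f (List.allFin n)) ≡ sum f
sum-allFin f = trans (cong Action.sum (map-tabulate (λ i → i) f)) (go f)
  where
  go : (f : Fin m → ℕ) → Action.sum (List.tabulate f) ≡ sum f
  go {zero}  f = refl
  go {suc m} f = cong (f zero +_) (go (f ∘ suc))

-- Darts and facial walks

-- Excluded middle may be assumed at finitely many vertices at once as long as the goal is absurd.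
-- This supplies the decisions for connectedness and for reachability by rotations.
¬¬-decidable : (P : Fin n → Set) → ¬ ¬ (∀ i → Dec (P i))
¬¬-decidable {zero}  P k = k (λ ())
¬¬-decidable {suc n} P k = ¬¬-excluded-middle {A = P zero} λ p? →
  ¬¬-decidable (P ∘ suc) λ ps? → k λ { zero → p? ; (suc i) → ps? i }

adj? : (G : Graph n) → ∀ u v → Dec (Adj G u v)
adj? G u v = T? (Graph.adj G u v)

adj-sym : (G : Graph n) → ∀ {u v} → Adj G u v → Adj G v u
adj-sym G {u} {v} = subst T (Graph.sym G u v)

adj-irrefl : (G : Graph n) → ∀ {u} → ¬ Adj G u u
adj-irrefl G {u} = subst T (Graph.irrefl G u)

handshake : (G : Graph n) → ## (adj? G) ≡ 2 * numEdges G
handshake {n} G = begin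
  ## (adj? G)                              ≡⟨ sum-cong-≗ (λ u → trans (sum-cong-≗ (split u)) (∑-distrib-+ (up u) (λ v → up v u))) ⟩
  sum (λ u → sum (up u) + sum (λ v → up v u))  ≡⟨ ∑-distrib-+ (λ u → sum (up u)) _ ⟩
  N + sum (λ u → sum (λ v → up v u))       ≡⟨ cong (N +_) (∑-comm (λ u v → up v u)) ⟩
  N + N                                    ≡⟨ cong (λ m → m + m) edges ⟩
  numEdges G + numEdges G                  ≡⟨ cong (numEdges G +_) (+-identityʳ _) ⟨
  2 * numEdges G                           ∎
  where
  open ≡-Reasoning
  open Graph G using (adj)
  up : Fin n → Fin n → ℕ
  up u v = ⟦ T? (adj u v ∧ ⌊ u <? v ⌋) ⟧
  N : ℕ
  N = sum (λ u → sum (up u))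
  edges : N ≡ numEdges G
  edges = sym (trans
    (sum-allFin (λ u → Subset.∣ Vec.tabulate (λ v → adj u v ∧ ⌊ u <? v ⌋) ∣))
    (sum-cong-≗ (λ u → ∣tabulate∣≡# (λ v → adj u v ∧ ⌊ u <? v ⌋))))
  split : ∀ u v → ⟦ T? (adj u v) ⟧ ≡ up u v + up v u
  split u v rewrite Graph.sym G v u with u <? v | v <? u
  ... | yes p | yes q = contradiction q (<-asym p)
  ... | yes p | no ¬q rewrite ∧-identityʳ (adj u v) | ∧-zeroʳ (adj u v) = sym (+-identityʳ _)
  ... | no ¬p | yes q rewrite ∧-identityʳ (adj u v) | ∧-zeroʳ (adj u v) = refl
  ... | no ¬p | no ¬q with <-cmp u v
  ...   | tri< p _ _ = contradiction p ¬p
  ...   | tri> _ _ q = contradiction q ¬q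
  ...   | tri≈ _ refl _ rewrite Graph.irrefl G u = refl

deg≡# : (G : Graph n) → ∀ u → deg G u ≡ # (adj? G u)
deg≡# G u = ∣tabulate∣≡# (Graph.adj G u)

record Subgraph (G : Graph n) : Set₁ where
  field
    E     : Fin n → Fin n → Set
    E?    : ∀ u v → Dec (E u v)
    E-sym : ∀ {u v} → E u v → E v u
    E⊆    : ∀ {u v} → E u v → Adj G u v

  Connected : Fin n → Fin n → Set
  Connected = Star E

  connected-sym : ∀ {u v} → Connected u v → Connected v u
  connected-sym = Star.reverse E-sym

  -- Independence refers to components, not to edges: such a set has at most one member in each
  -- component, so its size bounds the number of components from below without forming the quotient.
  Independent : (Fin n → Set) → Set
  Independent I = ∀ {u v} → I u → I v → Connected u v → u ≡ v

module _ {G : Graph n} where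

  dart-≡ : {d d′ : Dart G} → tail d ≡ tail d′ → tip d ≡ tip d′ → d ≡ d′
  dart-≡ {dart u v _} refl refl = cong (dart u v) (T-irrelevant _ _)

  reverse-involutive : (d : Dart G) → reverse (reverse d) ≡ d
  reverse-involutive d = dart-≡ refl refl

  reverse-injective : {d d′ : Dart G} → reverse d ≡ reverse d′ → d ≡ d′
  reverse-injective eq = dart-≡ (cong tip eq) (cong tail eq)

  tail≢tip : (d : Dart G) → tail d ≢ tip d
  tail≢tip (dart u _ e) refl = adj-irrefl G e

  module _ (R : RotationSystem G) where
    open RotationSystem R

    iterate : ℕ → Dart G → Dart G
    iterate zero    d = d
    iterate (suc k) d = iterate k (next d)

    orbit-iterate : ∀ {d d′} → Orbit next d d′ → ∃ λ k → iterate k d ≡ d′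
    orbit-iterate ε = 0 , refl
    orbit-iterate (refl ◅ p) with k , eq ← orbit-iterate p = suc k , eq

    iterate-+ : ∀ j k d → iterate (j + k) d ≡ iterate k (iterate j d)
    iterate-+ zero    k d = refl
    iterate-+ (suc j) k d = iterate-+ j k (next d)

    -- If a precedes b on the way from c, then as c follows a it lies on the
    -- way from a to b, which shortens the way from c to b: Euclid's algorithm.
    meet : ∀ N j k {a b c} → j + k ≤ N → next a ≡ c → next b ≡ c →
           iterate j c ≡ a → iterate k c ≡ b → a ≡ b
    meet N j k le na nb ja kb with ℕ.compare j k
    meet N j j le na nb ja kb | ℕ.equal j = trans (sym ja) kb
    meet zero j k le na nb ja kb | ℕ.less j m = contradiction (≤-trans (≤-reflexive (sym (+-suc j (j + m)))) le) λ ()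
    meet (suc N) j k {a} {c = c} le na nb ja kb | ℕ.less j m =
      meet N j m (≤-trans (+-monoʳ-≤ j (m≤n+m m j)) (ℕ.s≤s⁻¹ (≤-trans (≤-reflexive (sym (+-suc j (j + m)))) le))) na nb ja
        (trans (sym (trans (cong (λ k → iterate k c) (sym (+-suc j m)))
          (trans (iterate-+ j (suc m) c) (trans (cong (iterate m ∘ next) ja) (cong (iterate m) na))))) kb)
    meet (suc N) j k {b = b} {c = c} (s≤s le) na nb ja kb | ℕ.greater k m =
      meet N m k (≤-trans (+-monoˡ-≤ k (m≤n+m m k)) le) na nb
        (trans (sym (trans (cong (λ k → iterate k c) (sym (+-suc k m)))
          (trans (iterate-+ k (suc m) c) (trans (cong (iterate m ∘ next) kb) (cong (iterate m) nb))))) ja) kb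

    next-injective : ∀ {a b} → next a ≡ next b → a ≡ b
    next-injective {a} {b} eq
      with j , ja ← orbit-iterate (cyclic (next a) a (next-tail a))
         | k , kb ← orbit-iterate (cyclic (next a) b (trans (cong tail eq) (next-tail b)))
      = meet (j + k) j k ≤-refl refl (sym eq) ja kb

    faceStep-injective : ∀ {a b} → faceStep a ≡ faceStep b → a ≡ b
    faceStep-injective = reverse-injective ∘ next-injective

    faceStep-tail : ∀ d → tail (faceStep d) ≡ tip d
    faceStep-tail d = next-tail (reverse d)

    faceStep-reverse : ∀ d → faceStep (reverse d) ≡ next d
    faceStep-reverse d = cong next (reverse-involutive d)

    -- The faces of the embedding inherited by the subgraph H are the unions of
    -- faces of G obtained by merging across every edge that is not in H.
    record Labelling (H : Subgraph G) (f : ℕ) : Set where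
      open Subgraph H
      field
        label  : Dart G → Fin f
        onto   : ∀ k → ∃ λ d → label d ≡ k
        face   : ∀ d → label (faceStep d) ≡ label d
        merged : ∀ d → ¬ E (tail d) (tip d) → label (reverse d) ≡ label d

      -- `next d` is the face step of `reverse d`, so turning past an edge keeps the label once both
      -- sides of that edge agree.
      label-next : ∀ d → label (reverse d) ≡ label d → label (next d) ≡ label d
      label-next d eq = trans (cong label (sym (faceStep-reverse d))) (trans (face (reverse d)) eq)

-- Faces of subgraphs

-- The hypotheses fit three consecutive sides of a facial walk: successive sides have different
-- tails because there are no loops, so only the first and the third could coincide.
##-three : {E : Fin n → Fin n → Set} (E? : ∀ u v → Dec (E u v)) →
           ∀ {u₁ v₁ u₂ v₂ u₃ v₃} → E u₁ v₁ → E u₂ v₂ → E u₃ v₃ →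
           u₁ ≢ u₂ → u₂ ≢ u₃ → ¬ (u₁ ≡ u₃ × v₁ ≡ v₃) → 3 ≤ ## E?
##-three {n} {E} E? {u₁} {v₁} {u₂} {v₂} {u₃} {v₃} e₁ e₂ e₃ 1≢2 2≢3 1≢3 = ≤-trans
  (s≤s (≤-trans (s≤s (≤-trans (s≤s z≤n)
    (##-remove (λ _ _ → no id) One? (λ ()) id (refl , refl))))
    (##-remove One? Two? inj₁ (1≢2 ∘ proj₁) (inj₂ (refl , refl)))))
  (##-remove Two? E? (λ { (inj₁ (refl , refl)) → e₁ ; (inj₂ (refl , refl)) → e₂ })
    (λ { (inj₁ e) → 1≢3 e ; (inj₂ (e , _)) → 2≢3 e }) e₃)
  where
  One Two : Fin n → Fin n → Set
  One u v = u₁ ≡ u × v₁ ≡ v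
  Two u v = One u v ⊎ u₂ ≡ u × v₂ ≡ v
  One? : ∀ u v → Dec (One u v)
  One? u v = (u₁ ≟ u) ×-dec (v₁ ≟ v)
  Two? : ∀ u v → Dec (Two u v)
  Two? u v = One? u v ⊎-dec ((u₂ ≟ u) ×-dec (v₂ ≟ v))

module _ {G : Graph n} (planar : Planar G) where
  open Planar planar
  open RotationSystem rotation

  module _ {H : Subgraph G} {f : ℕ} (L : Labelling rotation H f) where
    open Subgraph H
    open Labelling L

    Side : Fin f → Fin n → Fin n → Set
    Side k u v = Σ (E u v) λ e → label (dart u v (E⊆ e)) ≡ k

    side? : ∀ k u v → Dec (Side k u v)
    side? k u v with E? u v
    ... | no ¬e = no (¬e ∘ proj₁)
    ... | yes e = map′ (e ,_) (λ (_ , eq) → trans (cong label (dart-≡ refl refl)) eq) (label _ ≟ k)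

    side : ∀ d {k} → E (tail d) (tip d) → label d ≡ k → Side k (tail d) (tip d)
    side d e eq = e , trans (cong label (dart-≡ refl refl)) eq

    side-unique : ∀ {j k u v} → Side j u v → Side k u v → j ≡ k
    side-unique (_ , eq) (_ , eq′) = trans (sym eq) (trans (cong label (dart-≡ refl refl)) eq′)

    -- Only these faces escape the usual count of three sides. Such a label turns out to fill a
    -- whole component of `G`, in which `H` has at most one edge.
    Deficient : Fin f → Set
    Deficient k = ¬ 3 ≤ ## (side? k)

    deficient? : ∀ k → Dec (Deficient k)
    deficient? k = ¬? (3 ≤? ## (side? k))

    sides-≤ : sum (λ k → ## (side? k)) ≤ ## E?
    sides-≤ = begin
      sum (λ k → ## (side? k))                                ≡⟨ ∑-comm (λ k u → # (side? k u)) ⟩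
      sum (λ u → sum (λ k → # (side? k u)))                   ≡⟨ sum-cong-≗ (λ u → ∑-comm (λ k v → ⟦ side? k u v ⟧)) ⟩
      sum (λ u → sum (λ v → # (λ k → side? k u v)))           ≤⟨ sum-mono _ _ (λ u → sum-mono _ _ (λ v → bound u v)) ⟩
      ## E?                                                   ∎
      where
      open ≤-Reasoning
      bound : ∀ u v → # (λ k → side? k u v) ≤ ⟦ E? u v ⟧
      bound u v = #≤⟦⟧ (λ k → side? k u v) (E? u v) proj₁ side-unique

    -- The facial walk of `H` is read off in `G`: after `d`, turn around its tip until an edge of
    -- `H` appears. Edges outside `H` have equal labels on both sides, so the label persists, and
    -- the turn ends at `reverse d` at the latest.
    next-side : ∀ d {k} → E (tail d) (tip d) → label d ≡ k →
                ∃ λ d′ → E (tail d′) (tip d′) × label d′ ≡ k × tail d′ ≡ tip d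
    next-side d {k} e eq = walk (cyclic (faceStep d) (reverse d) (next-tail _))
                                (trans (face d) eq) (next-tail _)
      where
      walk : ∀ {z} → Orbit next z (reverse d) → label z ≡ k → tail z ≡ tip d →
             ∃ λ d′ → E (tail d′) (tip d′) × label d′ ≡ k × tail d′ ≡ tip d
      walk {z} p eqz t with E? (tail z) (tip z) | p
      ... | yes ez | _        = z , ez , eqz , t
      ... | no ¬ez | ε        = contradiction (E-sym e) ¬ez
      ... | no ¬ez | refl ◅ q = walk q (trans (label-next z (merged z ¬ez)) eqz) (trans (next-tail z) t)

    -- A closed facial walk of length at most 2 in a simple graph traverses an
    -- edge back and forth.
    deficient-reverse : ∀ {k} → Deficient k → ∀ d → label d ≡ k → label (reverse d) ≡ k
    deficient-reverse {k} def d eq with E? (tail d) (tip d)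
    ... | no ¬e = trans (merged d ¬e) eq
    ... | yes e
      with d₂ , e₂ , eq₂ , t₂ ← next-side d e eq
      with d₃ , e₃ , eq₃ , t₃ ← next-side d₂ e₂ eq₂
      with (tail d ≟ tail d₃) ×-dec (tip d ≟ tip d₃)
    ... | yes (t , _) = trans (cong label (dart-≡ (sym t₂) (trans t t₃))) eq₂
    ... | no d≢d₃ = contradiction
      (##-three (side? k) (side d e eq) (side d₂ e₂ eq₂) (side d₃ e₃ eq₃)
        (λ t → tail≢tip d (trans t t₂)) (λ t → tail≢tip d₂ (trans t t₃)) d≢d₃)
      def

    module _ {k : Fin f} (def : Deficient k) where

      label-star : ∀ {d d′} → label d ≡ k → tail d ≡ tail d′ → label d′ ≡ k
      label-star {d} {d′} eq t = along (cyclic d d′ t) eq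
        where
        along : ∀ {z} → Orbit next z d′ → label z ≡ k → label d′ ≡ k
        along ε eqz = eqz
        along {z} (refl ◅ q) eqz =
          along q (trans (label-next z (trans (deficient-reverse def z eqz) (sym eqz))) eqz)

      label-component : ∀ {u w} → Star (Adj G) u w → ∀ {d d′} →
                        label d ≡ k → tail d ≡ u → tail d′ ≡ w → label d′ ≡ k
      label-component ε eq refl t = label-star eq (sym t)
      label-component {u} (_◅_ {j = v} a p) eq t t′ =
        label-component p (deficient-reverse def (dart u v a) (label-star eq t)) refl t′

    private
      module Comp = Classes components

    class-connected : ∀ {u v} → Comp.class u ≡ Comp.class v → Star (Adj G) u v
    class-connected = Equivalence.to (Comp.class-≡ _ _)

    Isolated : Fin n → Set
    Isolated v = T (deg G v ≡ᵇ 0)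

    isolated-¬adj : ∀ {u v} → Isolated u → ¬ Adj G u v
    isolated-¬adj {u} {v} i a = contradiction
      (≤-trans (#-remove (λ _ → no id) (adj? G u) {v} (λ ()) id a)
        (≤-reflexive (trans (sym (deg≡# G u)) (≡ᵇ⇒≡ (deg G u) 0 i))))
      λ ()

    isolated-connected : ∀ {u v} → Isolated u → Star (Adj G) u v → u ≡ v
    isolated-connected i ε       = refl
    isolated-connected i (a ◅ _) = contradiction a (isolated-¬adj i)

    -- A deficient label is used throughout its component, so every component
    -- has at most one deficient label or is an isolated vertex.
    deficient+isolated≤ : # deficient? + numIsolated G ≤ numComponents
    deficient+isolated≤ = begin
      # deficient? + numIsolated G         ≡⟨ cong (# deficient? +_) (∣tabulate∣≡# (λ v → deg G v ≡ᵇ 0)) ⟩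
      # deficient? + # isolated?           ≤⟨ +-mono-≤ deficient≤ isolated≤ ⟩
      # (¬? ∘ lone?) + # lone?             ≡⟨ +-comm (# (¬? ∘ lone?)) _ ⟩
      # lone? + # (¬? ∘ lone?)             ≡⟨ #-complement lone? ⟩
      numComponents                        ∎
      where
      open ≤-Reasoning
      isolated? : ∀ v → Dec (Isolated v)
      isolated? v = T? (deg G v ≡ᵇ 0)
      Lone : Fin numComponents → Set
      Lone c = ∃ λ v → Isolated v × Comp.class v ≡ c
      lone? : ∀ c → Dec (Lone c)
      lone? c = any? (λ v → isolated? v ×-dec (Comp.class v ≟ c))
      sample : Fin f → Dart G
      sample k = proj₁ (onto k)
      isolated≤ : # isolated? ≤ # lone?
      isolated≤ = #-injection isolated? lone? Comp.class (λ i → _ , i , refl)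
        (λ i _ eq → isolated-connected i (class-connected eq))
      deficient≤ : # deficient? ≤ # (¬? ∘ lone?)
      deficient≤ = #-injection deficient? (¬? ∘ lone?) (Comp.class ∘ tail ∘ sample)
        (λ { {k} _ (v , i , eq) → isolated-¬adj
               (subst Isolated (isolated-connected i (class-connected eq)) i) (edge (sample k)) })
        (λ { {j} {k} def _ eq → sym (trans (sym (proj₂ (onto k)))
               (label-component def (class-connected eq) (proj₂ (onto j)) refl refl)) })

    -- Each deficient face is granted three sides. A component of `G` pays for this at most once:
    -- either for its deficient label or for the face of an isolated vertex, which has no dart to be
    -- labelled.
    faces-≤ : 3 * (f + numIsolated G) ≤ ## E? + 3 * numComponents
    faces-≤ = begin
      3 * (f + numIsolated G)                                   ≡⟨ *-distribˡ-+ 3 f (numIsolated G) ⟩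
      3 * f + 3 * numIsolated G                                 ≤⟨ +-monoˡ-≤ (3 * numIsolated G) labels ⟩
      (## E? + 3 * # deficient?) + 3 * numIsolated G            ≡⟨ +-assoc (## E?) _ _ ⟩
      ## E? + (3 * # deficient? + 3 * numIsolated G)            ≡⟨ cong (## E? +_) (*-distribˡ-+ 3 (# deficient?) (numIsolated G)) ⟨
      ## E? + 3 * (# deficient? + numIsolated G)                ≤⟨ +-monoʳ-≤ (## E?) (*-monoʳ-≤ 3 deficient+isolated≤) ⟩
      ## E? + 3 * numComponents                                 ∎
      where
      open ≤-Reasoning
      enough : ∀ {m} (d : Dec (3 ≤ m)) → 3 ≤ m + 3 * ⟦ ¬? d ⟧
      enough (yes p) = ≤-trans p (m≤m+n _ 0)
      enough (no _)  = m≤n+m 3 _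
      labels : 3 * f ≤ ## E? + 3 * # deficient?
      labels = begin
        3 * f                                                        ≡⟨ *-comm 3 f ⟩
        f * 3                                                        ≡⟨ sum-const f 3 ⟨
        sum {f} (λ _ → 3)                                            ≤⟨ sum-mono _ _ (λ k → enough (3 ≤? ## (side? k))) ⟩
        sum (λ k → ## (side? k) + 3 * ⟦ deficient? k ⟧)              ≡⟨ ∑-distrib-+ (λ k → ## (side? k)) _ ⟩
        sum (λ k → ## (side? k)) + sum (λ k → 3 * ⟦ deficient? k ⟧)  ≡⟨ cong (sum (λ k → ## (side? k)) +_) (*-distribˡ-sum 3 (λ k → ⟦ deficient? k ⟧)) ⟨
        sum (λ k → ## (side? k)) + 3 * # deficient?                  ≤⟨ +-monoˡ-≤ (3 * # deficient?) sides-≤ ⟩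
        ## E? + 3 * # deficient?                                     ∎

-- Euler's formula for subgraphs

module _ {G : Graph n} where

  module _ (H : Subgraph G) {u v : Fin n} (a : Adj G u v) where
    open Subgraph H

    IsNew : Fin n → Fin n → Set
    IsNew s t = (s ≡ u × t ≡ v) ⊎ (s ≡ v × t ≡ u)

    insert : Subgraph G
    insert = record
      { E     = λ s t → E s t ⊎ IsNew s t
      ; E?    = λ s t → E? s t ⊎-dec (((s ≟ u) ×-dec (t ≟ v)) ⊎-dec ((s ≟ v) ×-dec (t ≟ u)))
      ; E-sym = λ where
          (inj₁ e)                    → inj₁ (E-sym e)
          (inj₂ (inj₁ (refl , refl))) → inj₂ (inj₂ (refl , refl))
          (inj₂ (inj₂ (refl , refl))) → inj₂ (inj₁ (refl , refl))
      ; E⊆    = λ where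
          (inj₁ e)                    → E⊆ e
          (inj₂ (inj₁ (refl , refl))) → a
          (inj₂ (inj₂ (refl , refl))) → adj-sym G a
      }

    open Subgraph insert using () renaming (E to E⁺; E? to E⁺?; Connected to Connected⁺)

    insert-edges : ¬ E u v → 2 + ## E? ≤ ## E⁺?
    insert-edges ¬e = ≤-trans
      (s≤s (##-remove E? Half? inj₁ ¬e (inj₂ (refl , refl))))
      (##-remove Half? E⁺? (λ { (inj₁ e) → inj₁ e ; (inj₂ e) → inj₂ (inj₁ e) })
        (λ { (inj₁ e) → ¬e (E-sym e) ; (inj₂ (refl , _)) → adj-irrefl G a })
        (inj₂ (inj₂ (refl , refl))))
      where
      Half? : ∀ s t → Dec (E s t ⊎ (s ≡ u × t ≡ v))
      Half? s t = E? s t ⊎-dec ((s ≟ u) ×-dec (t ≟ v))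

    -- Walks in the enlarged graph can be shortcut so that they cross the new edge at most once; the
    -- constructors are the three ways to do so.
    data Via (s t : Fin n) : Set where
      avoids  : Connected s t → Via s t
      forward : Connected s u → Connected v t → Via s t
      backward : Connected s v → Connected u t → Via s t

    via : ∀ {s t} → Connected⁺ s t → Via s t
    via ε = avoids ε
    via (inj₁ e ◅ p) with via p
    ... | avoids q    = avoids (e ◅ q)
    ... | forward q r = forward (e ◅ q) r
    ... | backward q r = backward (e ◅ q) r
    via (inj₂ (inj₁ (refl , refl)) ◅ p) with via p
    ... | avoids q    = forward ε q
    ... | forward q r = forward ε r
    ... | backward q r = avoids r
    via (inj₂ (inj₂ (refl , refl)) ◅ p) with via p
    ... | avoids q    = backward ε q
    ... | forward q r = avoids r
    ... | backward q r = backward ε r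

    connected⁺⇒ : Connected u v → ∀ {s t} → Connected⁺ s t → Connected s t
    connected⁺⇒ c p with via p
    ... | avoids q    = q
    ... | forward q r = q ◅◅ c ◅◅ r
    ... | backward q r = q ◅◅ connected-sym c ◅◅ r

    module _ {I : Fin n → Set} (ind : Independent I) {s t : Fin n} (Is : I s) (It : I t)
             (s≢t : s ≢ t) (p : Connected⁺ s t) where

      -- If s hangs on one end of the new edge, then every other connection
      -- between members of I uses that end, hence s.
      drop-independent : Subgraph.Independent insert (λ w → I w × w ≢ s)
      drop-independent (Ix , x≢s) (Iy , y≢s) q with via q | via p
      ... | avoids q     | _          = ind Ix Iy q
      ... | _         | avoids p      = contradiction (ind Is It p) s≢t
      ... | forward xu _ | forward su _  = contradiction (ind Ix Is (xu ◅◅ connected-sym su)) x≢s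
      ... | forward _ vy | backward sv _  = contradiction (ind Iy Is (connected-sym (sv ◅◅ vy))) y≢s
      ... | backward _ uy | forward su _  = contradiction (ind Iy Is (connected-sym (su ◅◅ uy))) y≢s
      ... | backward xv _ | backward sv _  = contradiction (ind Ix Is (xv ◅◅ connected-sym sv)) x≢s

    module _ {R : RotationSystem G} {f : ℕ} (L : Labelling R insert f) where
      open Labelling L
      open RotationSystem R

      new : Dart G
      new = dart u v a

      -- Otherwise, with U the component of u, stepping along the label of new
      -- outside U, and back across the cut whenever it is crossed, would be
      -- an injection of finitely many darts that misses new.
      bridge-label : ¬ Connected u v → label (reverse new) ≡ label new
      bridge-label ¬c = decidable-stable (_ ≟ _) λ differ →
        ¬¬-decidable (Connected u) λ U? → escape differ U?
        where
        module _ (differ : label (reverse new) ≢ label new) (U? : ∀ w → Dec (Connected u w)) where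

          Outside : Dart G → Set
          Outside d = label d ≡ label new × ¬ Connected u (tip d)

          OutTail : Dart G → Set
          OutTail d = label d ≡ label new × ¬ Connected u (tail d)

          return : Dart G → Dart G
          return d with U? (tip d)
          ... | yes _ = reverse d
          ... | no _  = d

          return-outside : ∀ {d} → OutTail d → Outside (return d) × return d ≢ new
          return-outside {d} (eq , out) with U? (tip d)
          ... | no ¬in = (eq , ¬in) , λ { refl → out ε }
          -- A dart that enters U from outside is no edge of `H`, and it is not `reverse new`, which
          -- has another label. Hence it lies outside `insert` and both its sides carry the same
          -- label.
          ... | yes in′ with Subgraph.E? insert (tail d) (tip d)
          ...   | no ¬e = (trans (merged d ¬e) eq , out) ,
                          λ { refl → ¬e (inj₂ (inj₂ (refl , refl))) }
          ...   | yes (inj₁ e) = contradiction (in′ ◅◅ (E-sym e ◅ ε)) out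
          ...   | yes (inj₂ (inj₁ (refl , _))) = contradiction ε out
          ...   | yes (inj₂ (inj₂ (refl , refl))) = contradiction (trans (cong label (dart-≡ refl refl)) eq) differ

          return-injective : ∀ {d d′} → OutTail d → OutTail d′ → return d ≡ return d′ → d ≡ d′
          return-injective {d} {d′} (_ , out) (_ , out′) eq with U? (tip d) | U? (tip d′)
          ... | yes _  | yes _   = reverse-injective eq
          ... | no _   | no _    = eq
          ... | yes p  | no _    = contradiction (subst (Connected u) (cong tail eq) p) out′
          ... | no _   | yes p   = contradiction (subst (Connected u) (cong tail (sym eq)) p) out

          step-outTail : ∀ {d} → Outside d → OutTail (faceStep d)
          step-outTail {d} (eq , out) =
            trans (face d) eq , out ∘ subst (Connected u) (faceStep-tail R d)

          run : ℕ → Dart G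
          run zero    = new
          run (suc k) = return (faceStep (run k))

          run-outside : ∀ k → Outside (run k)
          run-outside zero    = refl , ¬c
          run-outside (suc k) = proj₁ (return-outside (step-outTail (run-outside k)))

          run-injective : ∀ j k → run j ≡ run k → j ≡ k
          run-injective zero    zero    eq = refl
          run-injective zero    (suc k) eq = contradiction (sym eq) (proj₂ (return-outside (step-outTail (run-outside k))))
          run-injective (suc j) zero    eq = contradiction eq (proj₂ (return-outside (step-outTail (run-outside j))))
          run-injective (suc j) (suc k) eq = cong suc (run-injective j k (faceStep-injective R
            (return-injective (step-outTail (run-outside j)) (step-outTail (run-outside k)) eq)))

          code : Dart G → Fin (n * n)
          code d = combine (tail d) (tip d)

          code-injective : ∀ {d d′} → code d ≡ code d′ → d ≡ d′
          code-injective eq with t , t′ ← combine-injective _ _ _ _ eq = dart-≡ t t′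

          escape : ⊥
          escape with i , j , i<j , eq ← pigeonhole (n<1+n (n * n)) (code ∘ run ∘ toℕ)
            = <-irrefl (run-injective (toℕ i) (toℕ j) (code-injective eq)) i<j

-- Serves the deletion of an edge between two different faces, which become one: the value `i` is
-- removed and sent to the image of `j`.
merge : ∀ {f} (i j : Fin (suc f)) → i ≢ j → Fin (suc f) → Fin f
merge i j i≢j k with i ≟ k
... | yes _  = punchOut i≢j
... | no i≢k = punchOut i≢k

merge-≡ : ∀ {f} (i j : Fin (suc f)) (i≢j : i ≢ j) → merge i j i≢j i ≡ merge i j i≢j j
merge-≡ i j i≢j with i ≟ i | i ≟ j
... | no i≢i | _      = contradiction refl i≢i
... | yes _  | yes eq = contradiction eq i≢j
... | yes _  | no _   = punchOut-cong i refl

merge-onto : ∀ {f} (i j : Fin (suc f)) (i≢j : i ≢ j) k → merge i j i≢j (punchIn i k) ≡ k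
merge-onto i j i≢j k with i ≟ punchIn i k
... | yes eq = contradiction (sym eq) (punchInᵢ≢i i k)
... | no _   = trans (punchOut-cong i refl) (punchOut-punchIn i)

module _ {G : Graph n} {R : RotationSystem G} (H : Subgraph G) {u v : Fin n} (a : Adj G u v) where
  open Subgraph H

  private
    e : Dart G
    e = dart u v a

  delete-same : ∀ {f} (L : Labelling R (insert H a) f) → let open Labelling L in
                label (reverse e) ≡ label e → Labelling R H f
  delete-same L same = record { label = label ; onto = onto ; face = face ; merged = merged′ }
    where
    open Labelling L
    merged′ : ∀ d → ¬ E (tail d) (tip d) → label (reverse d) ≡ label d
    merged′ d ¬e with Subgraph.E? (insert H a) (tail d) (tip d)
    ... | no ¬e⁺ = merged d ¬e⁺
    ... | yes (inj₁ e) = contradiction e ¬e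
    ... | yes (inj₂ (inj₁ (refl , refl))) =
      trans (cong label (dart-≡ refl refl)) (trans same (cong label (dart-≡ refl refl)))
    ... | yes (inj₂ (inj₂ (refl , refl))) =
      trans (cong label (dart-≡ refl refl)) (trans (sym same) (cong label (dart-≡ refl refl)))

  relabel : ∀ {f g} (L : Labelling R (insert H a) f) → let open Labelling L in
            (h : Fin f → Fin g) → (∀ k → ∃ λ j → h j ≡ k) → Labelling R (insert H a) g
  relabel L h h-onto = record
    { label  = h ∘ label
    ; onto   = λ k → let j , hj = h-onto k ; d , eq = onto j in d , trans (cong h eq) hj
    ; face   = cong h ∘ face
    ; merged = λ d ¬e → cong h (merged d ¬e)
    }
    where open Labelling L

  delete-differ : ∀ {f} (L : Labelling R (insert H a) (suc f)) → let open Labelling L in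
                  label (reverse e) ≢ label e → Labelling R H f
  delete-differ L differ = delete-same
    (relabel L (merge (label (reverse e)) (label e) differ)
      (λ k → punchIn _ k , merge-onto _ _ differ k))
    (merge-≡ _ _ differ)
    where open Labelling L

module _ {G : Graph n} (planar : Planar G) where
  open Planar planar

  private
    c iso : ℕ
    c   = numComponents
    iso = numIsolated G
    module Comp = Classes components
    module Face = Classes faceCycles

  -- Euler's formula for the subgraph, multiplied by 2; the components of the
  -- subgraph are counted from below by independent sets.
  record EulerBound (H : Subgraph G) : Set₁ where
    open Subgraph H
    field
      {faces}   : ℕ
      labelling : Labelling rotation H faces
      bound     : ∀ {I : Fin n → Set} (I? : ∀ u → Dec (I u)) → Independent I →
                  ## E? + 2 * # I? + 2 * c ≤ 2 * n + 2 * (faces + iso)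

  euler-whole : (H : Subgraph G) → (∀ {u v} → Adj G u v → Subgraph.E H u v) → EulerBound H
  euler-whole H ⊆E = record
    { labelling = record
      { label  = Face.class
      ; onto   = Face.surjective
      ; face   = λ d → sym (Equivalence.from (Face.class-≡ d _) (refl ◅ ε))
      ; merged = λ d ¬e → contradiction (⊆E (edge d)) ¬e
      }
    ; bound = λ {I} I? ind → begin
        ## E? + 2 * # I? + 2 * c                 ≤⟨ +-monoˡ-≤ (2 * c) (+-mono-≤
                                                     (≤-trans (##-mono E? (adj? G) E⊆) (≤-reflexive (handshake G)))
                                                     (*-monoʳ-≤ 2 (I≤c I? ind))) ⟩
        2 * numEdges G + 2 * c + 2 * c           ≡⟨ regroup (numEdges G) c ⟩
        2 * (numEdges G + 2 * c)                 ≡⟨ cong (2 *_) genus-zero ⟨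
        2 * (n + (numFaceCycles + iso))          ≡⟨ *-distribˡ-+ 2 n _ ⟩
        2 * n + 2 * (numFaceCycles + iso)        ∎
    }
    where
    open Subgraph H
    open ≤-Reasoning
    regroup : ∀ m c → 2 * m + 2 * c + 2 * c ≡ 2 * (m + 2 * c)
    regroup = solve-∀
    I≤c : ∀ {I : Fin n → Set} (I? : ∀ u → Dec (I u)) → Independent I → # I? ≤ c
    I≤c I? ind = ≤-trans
      (#-injection I? (λ _ → yes tt) Comp.class (λ _ → tt)
        (λ Iu Iv eq → ind Iu Iv (Star.map ⊆E (Equivalence.to (Comp.class-≡ _ _) eq))))
      (≤-reflexive (#-true (λ _ → yes tt) (λ _ → tt)))

  module _ (H : Subgraph G) {u v : Fin n} (a : Adj G u v) (¬e : ¬ Subgraph.E H u v) where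
    open Subgraph H

    private
      e : Dart G
      e = dart u v a
      E⁺? : ∀ s t → Dec (Subgraph.E (insert H a) s t)
      E⁺? = Subgraph.E? (insert H a)

    -- The deletion lowers the dart count by two. If one face lies on both sides, the faces stay and
    -- a component may split, at the cost of one member of `I`; should the edge be no bridge, the
    -- inequality only gains. If two faces merge, `bridge-label` shows that `u` and `v` remain
    -- connected, so `I` is independent in `insert H a` as well.
    euler-delete : EulerBound (insert H a) → EulerBound H
    euler-delete record { faces = f ; labelling = L ; bound = bound }
      with Labelling.label L (reverse e) ≟ Labelling.label L e
    ... | yes same = record { labelling = delete-same H a L same ; bound = bound′ }
      where
      bound′ : ∀ {I : Fin n → Set} (I? : ∀ w → Dec (I w)) → Independent I →
               ## E? + 2 * # I? + 2 * c ≤ 2 * n + 2 * (f + iso)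
      -- Whether the new edge connects two members of `I` is not decided, but the inequality is
      -- stable under double negation.
      bound′ {I} I? ind = decidable-stable (_ ≤? _) λ ¬bound →
        ¬¬-excluded-middle {A = ∃₂ λ s t → I s × I t × s ≢ t × Subgraph.Connected (insert H a) s t} λ where
          (yes (s , t , Is , It , s≢t , p)) → ¬bound (begin
            ## E? + 2 * # I? + 2 * c              ≤⟨ +-monoˡ-≤ (2 * c) (+-monoʳ-≤ (## E?)
                                                       (*-monoʳ-≤ 2 (#-insert I? (drop? s) s (split s)))) ⟩
            ## E? + 2 * suc (# (drop? s)) + 2 * c ≡⟨ regroup (## E?) (# (drop? s)) c ⟩
            2 + ## E? + 2 * # (drop? s) + 2 * c   ≤⟨ +-monoˡ-≤ (2 * c) (+-monoˡ-≤ _ (insert-edges H a ¬e)) ⟩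
            ## E⁺? + 2 * # (drop? s) + 2 * c      ≤⟨ bound (drop? s) (drop-independent H a ind Is It s≢t p) ⟩
            2 * n + 2 * (f + iso)                 ∎)
          (no none) → ¬bound (begin
            ## E? + 2 * # I? + 2 * c              ≤⟨ +-monoˡ-≤ (2 * c) (+-monoˡ-≤ _ (≤-trans (m≤n+m _ 2) (insert-edges H a ¬e))) ⟩
            ## E⁺? + 2 * # I? + 2 * c             ≤⟨ bound I? (λ {s} {t} Is It p → decidable-stable (s ≟ t)
                                                       λ s≢t → none (s , t , Is , It , s≢t , p)) ⟩
            2 * n + 2 * (f + iso)                 ∎)
        where
        open ≤-Reasoning
        drop? : ∀ s w → Dec (I w × w ≢ s)
        drop? s w = I? w ×-dec ¬? (w ≟ s)
        split : ∀ s {w} → I w → s ≡ w ⊎ (I w × w ≢ s)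
        split s {w} Iw with w ≟ s
        ... | yes eq = inj₁ (sym eq)
        ... | no neq = inj₂ (Iw , neq)
        regroup : ∀ m k c → m + 2 * suc k + 2 * c ≡ 2 + m + 2 * k + 2 * c
        regroup = solve-∀
    euler-delete record { faces = zero ; labelling = L } | no differ with Labelling.label L e
    ... | ()
    euler-delete record { faces = suc f ; labelling = L ; bound = bound } | no differ =
      record { labelling = delete-differ H a L differ ; bound = bound′ }
      where
      bound′ : ∀ {I : Fin n → Set} (I? : ∀ w → Dec (I w)) → Independent I →
               ## E? + 2 * # I? + 2 * c ≤ 2 * n + 2 * (f + iso)
      bound′ {I} I? ind = decidable-stable (_ ≤? _) λ ¬bound →
        ¬¬-excluded-middle {A = Connected u v} λ where
          (no ¬c) → differ (bridge-label H a L ¬c)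
          (yes con) → ¬bound (+-cancelˡ-≤ 2 _ _ (begin
            2 + (## E? + 2 * # I? + 2 * c)        ≤⟨ +-monoˡ-≤ (2 * c) (+-monoˡ-≤ (2 * # I?) (insert-edges H a ¬e)) ⟩
            ## E⁺? + 2 * # I? + 2 * c             ≤⟨ bound I? (λ Is It p → ind Is It (connected⁺⇒ H a con p)) ⟩
            2 * n + 2 * (suc f + iso)             ≡⟨ regroup n (f + iso) ⟩
            2 + (2 * n + 2 * (f + iso))           ∎))
        where
        open ≤-Reasoning
        regroup : ∀ n k → 2 * n + 2 * suc k ≡ 2 + (2 * n + 2 * k)
        regroup = solve-∀

  -- The induction descends from `G`: `k` bounds the number of darts of `G` missing from `H`, and
  -- `H` arises from `insert H a` by a deletion.
  euler : ∀ k (H : Subgraph G) → ## (adj? G) ≤ k + ## (Subgraph.E? H) → EulerBound H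
  euler k H le with any? (λ u → any? (λ v → adj? G u v ×-dec ¬? (Subgraph.E? H u v)))
  ... | no none = euler-whole H λ {u} {v} a →
    decidable-stable (Subgraph.E? H u v) (λ ¬e → none (u , v , a , ¬e))
  euler zero H le | yes (u , v , a , ¬e) =
    contradiction (≤-trans (##-remove (Subgraph.E? H) (adj? G) (Subgraph.E⊆ H) ¬e a) le) (<-irrefl refl)
  euler (suc k) H le | yes (u , v , a , ¬e) = euler-delete H a ¬e (euler k (insert H a) (begin
    ## (adj? G)                             ≤⟨ le ⟩
    suc k + ## (Subgraph.E? H)              ≡⟨ +-suc k _ ⟨
    k + suc (## (Subgraph.E? H))            ≤⟨ +-monoʳ-≤ k (≤-trans (m≤n+m _ 1) (insert-edges H a ¬e)) ⟩
    k + ## (Subgraph.E? (insert H a))       ∎))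
    where open ≤-Reasoning

  -- Three times Euler's bound, with the faces eliminated by `faces-≤`. The terms `6 * c` cancel, so
  -- the components of `G` disappear and only those of `H`, represented by `I`, remain. The factor 6
  -- is twice 3 because `E?` is counted on ordered pairs.
  sparse : (H : Subgraph G) → let open Subgraph H in
           ∀ {I : Fin n → Set} (I? : ∀ u → Dec (I u)) → Independent I → ## E? + 6 * # I? ≤ 6 * n
  sparse H {I} I? ind = +-cancelˡ-≤ (2 * ## E? + 6 * c) _ _ (begin
    2 * ## E? + 6 * c + (## E? + 6 * # I?)     ≡⟨ regroup₁ (## E?) (# I?) c ⟩
    3 * (## E? + 2 * # I? + 2 * c)             ≤⟨ *-monoʳ-≤ 3 (bound I? ind) ⟩
    3 * (2 * n + 2 * (faces + iso))            ≡⟨ regroup₂ n (faces + iso) ⟩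
    6 * n + 2 * (3 * (faces + iso))            ≤⟨ +-monoʳ-≤ (6 * n) (*-monoʳ-≤ 2 (faces-≤ planar labelling)) ⟩
    6 * n + 2 * (## E? + 3 * c)                ≡⟨ regroup₃ n (## E?) c ⟩
    2 * ## E? + 6 * c + 6 * n                  ∎)
    where
    open Subgraph H
    open EulerBound (euler (## (adj? G)) H (m≤m+n _ _))
    open ≤-Reasoning
    regroup₁ : ∀ m k c → 2 * m + 6 * c + (m + 6 * k) ≡ 3 * (m + 2 * k + 2 * c)
    regroup₁ = solve-∀
    regroup₂ : ∀ n f → 3 * (2 * n + 2 * f) ≡ 6 * n + 2 * (3 * f)
    regroup₂ = solve-∀
    regroup₃ : ∀ n m c → 6 * n + 2 * (m + 3 * c) ≡ 2 * m + 6 * c + 6 * n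
    regroup₃ = solve-∀

-- Matchings as involutions

module _ (i j : Fin n) where

  transpose-left : transpose i j i ≡ j
  transpose-left rewrite dec-true (i ≟ i) refl = refl

  transpose-right : transpose i j j ≡ i
  transpose-right with j ≟ i
  ... | yes eq = eq
  ... | no _ rewrite dec-true (j ≟ j) refl = refl

  transpose-other : ∀ {k} → k ≢ i → k ≢ j → transpose i j k ≡ k
  transpose-other {k} k≢i k≢j rewrite dec-false (k ≟ i) k≢i | dec-false (k ≟ j) k≢j = refl

transpose-comm : (i j k : Fin n) → transpose i j k ≡ transpose j i k
transpose-comm i j k = by-cases (k ≟ i) (k ≟ j)
  where
  by-cases : Dec (k ≡ i) → Dec (k ≡ j) → transpose i j k ≡ transpose j i k
  by-cases (yes refl) _          = trans (transpose-left i j) (sym (transpose-right j i))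
  by-cases (no _)     (yes refl) = trans (transpose-right i j) (sym (transpose-left j i))
  by-cases (no k≢i)   (no k≢j)   = trans (transpose-other i j k≢i k≢j) (sym (transpose-other j i k≢j k≢i))

transpose-involutive : (i j k : Fin n) → transpose i j (transpose i j k) ≡ k
transpose-involutive i j k = trans (transpose-comm i j (transpose i j k)) (transpose-inverse j i {k})

conjugate : Fin n → Fin n → (Fin n → Fin n) → Fin n → Fin n
conjugate v w f = transpose v w ∘ f ∘ transpose v w

fixed? : (f : Fin n → Fin n) → ∀ z → Dec (f z ≡ z)
fixed? f z = f z ≟ z

differ? : (f g : Fin n → Fin n) → ∀ z → Dec (f z ≢ g z)
differ? f g z = ¬? (f z ≟ g z)

#-fixed-cong : {f g : Fin n → Fin n} → f ≗ g → # (fixed? f) ≡ # (fixed? g)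
#-fixed-cong {f = f} {g} f≗g = ≤-antisym
  (#-mono (fixed? f) (fixed? g) (λ {z} eq → trans (sym (f≗g z)) eq))
  (#-mono (fixed? g) (fixed? f) (λ {z} eq → trans (f≗g z) eq))

module _ (v w : Fin n) where

  private
    τ : Fin n → Fin n
    τ = transpose v w
    ττ : ∀ z → τ (τ z) ≡ z
    ττ = transpose-involutive v w

  transpose-injective : ∀ {y z} → τ y ≡ τ z → y ≡ z
  transpose-injective {y} {z} eq = trans (sym (ττ y)) (trans (cong τ eq) (ττ z))

  conjugate-fixed : ∀ f {z} → conjugate v w f z ≡ z → f (τ z) ≡ τ z
  conjugate-fixed f {z} eq = trans (sym (ττ (f (τ z)))) (cong τ eq)

  fixed-conjugate : ∀ f {z} → f z ≡ z → conjugate v w f (τ z) ≡ τ z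
  fixed-conjugate f {z} eq = trans (cong (τ ∘ f) (ττ z)) (cong τ eq)

  #-fixed-conjugate : ∀ f → # (fixed? (conjugate v w f)) ≡ # (fixed? f)
  #-fixed-conjugate f = ≤-antisym
    (#-injection (fixed? (conjugate v w f)) (fixed? f) τ (conjugate-fixed f) (λ _ _ → transpose-injective))
    (#-injection (fixed? f) (fixed? (conjugate v w f)) τ (fixed-conjugate f) (λ _ _ → transpose-injective))

  #-differ-conjugate : ∀ f g → # (differ? (conjugate v w f) (conjugate v w g)) ≤ # (differ? f g)
  #-differ-conjugate f g = #-injection (differ? (conjugate v w f) (conjugate v w g)) (differ? f g) τ
    (λ ne eq → ne (cong τ eq)) (λ _ _ → transpose-injective)

-- A matching is encoded by the involution exchanging the ends of each of its
-- edges; the fixed points are the unmatched vertices.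
record Matching (E : Fin n → Fin n → Set) (f : Fin n → Fin n) : Set where
  field
    involutive : ∀ z → f (f z) ≡ z
    edges      : ∀ {z} → f z ≢ z → E z (f z)

  injective : ∀ {y z} → f y ≡ f z → y ≡ z
  injective eq = trans (sym (involutive _)) (trans (cong f eq) (involutive _))

open Matching public

matching-cong : ∀ {E : Fin n → Fin n → Set} {f g} → f ≗ g → Matching E f → Matching E g
matching-cong {E = E} {f} {g} f≗g m = record
  { involutive = λ z → trans (sym (trans (f≗g (f z)) (cong g (f≗g z)))) (involutive m z)
  ; edges      = λ {z} ne → subst (E z) (f≗g z) (edges m (ne ∘ trans (sym (f≗g z))))
  }

-- Exchanging the edge u – w of f for v – u, where v is unmatched and w = f u,
-- amounts to conjugating f by the transposition of v and w.
module Rotate {E : Fin n → Fin n → Set} {f : Fin n → Fin n} (m : Matching E f)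
              {v u w : Fin n} (fv : f v ≡ v) (fu : f u ≡ w) (u≢w : u ≢ w) where

  f′ : Fin n → Fin n
  f′ = conjugate v w f

  fw : f w ≡ u
  fw = trans (cong f (sym fu)) (involutive m u)

  u≢v : u ≢ v
  u≢v refl = u≢w (trans (sym fv) fu)

  v≢w : v ≢ w
  v≢w refl = u≢v (trans (sym fw) fv)

  at-v : f′ v ≡ u
  at-v = trans (cong (transpose v w ∘ f) (transpose-left v w))
        (trans (cong (transpose v w) fw) (transpose-other v w u≢v u≢w))

  at-w : f′ w ≡ w
  at-w = trans (cong (transpose v w ∘ f) (transpose-right v w))
        (trans (cong (transpose v w) fv) (transpose-left v w))

  at-u : f′ u ≡ v
  at-u = trans (cong (transpose v w ∘ f) (transpose-other v w u≢v u≢w))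
        (trans (cong (transpose v w) fu) (transpose-right v w))

  elsewhere : ∀ {z} → z ≢ v → z ≢ w → z ≢ u → f′ z ≡ f z
  elsewhere {z} z≢v z≢w z≢u = trans (cong (transpose v w ∘ f) (transpose-other v w z≢v z≢w))
    (transpose-other v w (λ eq → z≢v (injective m (trans eq (sym fv))))
                         (λ eq → z≢u (injective m (trans eq (sym fu)))))

  data Position : Fin n → Set where
    is-v  : Position v
    is-w  : Position w
    is-u  : Position u
    other : ∀ {z} → f′ z ≡ f z → Position z

  position : ∀ z → Position z
  position z with z ≟ v | z ≟ w | z ≟ u
  ... | yes refl | _        | _        = is-v
  ... | _        | yes refl | _        = is-w
  ... | _        | _        | yes refl = is-u
  ... | no z≢v   | no z≢w   | no z≢u   = other (elsewhere z≢v z≢w z≢u)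

  rotated : (∀ {y z} → E y z → E z y) → E v u → Matching E f′
  rotated E-sym e = record
    { involutive = λ z → trans (cong (transpose v w ∘ f) (transpose-involutive v w (f (transpose v w z))))
                        (trans (cong (transpose v w) (involutive m (transpose v w z))) (transpose-involutive v w z))
    ; edges = λ {z} → edges′ (position z)
    }
    where
    edges′ : ∀ {z} → Position z → f′ z ≢ z → E z (f′ z)
    edges′ is-v       ne = subst (E v) (sym at-v) e
    edges′ is-w       ne = contradiction at-w ne
    edges′ is-u       ne = subst (E u) (sym at-u) (E-sym e)
    edges′ (other eq) ne = subst (E _) (sym eq) (edges m (ne ∘ trans eq))

module _ {E F : Fin n → Fin n → Set} {f g : Fin n → Fin n} (m : Matching E f) (k : Matching F g) where

  -- The rotation along `v – g v` makes `f` agree with `g` at both ends, where they differed. It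
  -- spoils nothing at the newly missed `w`: there `f w ≡ g v`, so `g w` was different already.
  closer : ∀ {v} → f v ≡ v → g v ≢ v → f (g v) ≢ g v →
           2 + # (differ? (conjugate v (f (g v)) f) g) ≤ # (differ? f g)
  closer {v} fv gv≢v fgv≢gv = #-remove₂ (differ? f′ g) (differ? f g) {v} {g v}
    (λ {z} → shrink (position z))
    (λ ne → ne at-v) (λ eq → gv≢v (trans (sym eq) fv))
    (λ ne → ne (trans at-u (sym (involutive k v))))
    (λ eq → v≢w (sym (trans eq (involutive k v))))
    (gv≢v ∘ sym)
    where
    open Rotate m fv refl (fgv≢gv ∘ sym)
    shrink : ∀ {z} → Position z → f′ z ≢ g z → f z ≢ g z
    shrink is-v       ne eq = ne at-v
    shrink is-w       ne eq = v≢w (injective k (trans (sym fw) eq))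
    shrink is-u       ne eq = ne (trans at-u (sym (involutive k v)))
    shrink (other e)  ne eq = ne (trans e eq)

augment : ∀ {E : Fin n → Fin n → Set} {f} → (∀ {y z} → E y z → E z y) → Matching E f →
          ∀ {v u} → f v ≡ v → f u ≡ u → v ≢ u → E v u →
          ∃ λ g → Matching E g × # (fixed? g) < # (fixed? f)
augment {n} {E} {f} E-sym m {v} {u} fv fu v≢u e = g ,
  record { involutive = λ z → inv z (z ≟ v) (z ≟ u) ; edges = λ {z} → edg (z ≟ v) (z ≟ u) } ,
  #-remove (fixed? g) (fixed? f) {v} (λ {z} → sub (z ≟ v) (z ≟ u)) (λ eq → v≢u (trans (sym eq) gv)) fv
  where
  g : Fin n → Fin n
  g = transpose v u ∘ f
  gv : g v ≡ u
  gv = trans (cong (transpose v u) fv) (transpose-left v u)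
  gu : g u ≡ v
  gu = trans (cong (transpose v u) fu) (transpose-right v u)
  gz : ∀ {z} → z ≢ v → z ≢ u → g z ≡ f z
  gz z≢v z≢u = transpose-other v u (λ eq → z≢v (injective m (trans eq (sym fv))))
                                   (λ eq → z≢u (injective m (trans eq (sym fu))))
  inv : ∀ z → Dec (z ≡ v) → Dec (z ≡ u) → g (g z) ≡ z
  inv z (yes refl) _          = trans (cong g gv) gu
  inv z (no _)     (yes refl) = trans (cong g gu) gv
  inv z (no z≢v)   (no z≢u)   = trans (cong g (gz z≢v z≢u))
    (trans (cong (transpose v u) (involutive m z)) (transpose-other v u z≢v z≢u))
  edg : ∀ {z} → Dec (z ≡ v) → Dec (z ≡ u) → g z ≢ z → E z (g z)
  edg (yes refl) _          ne = subst (E v) (sym gv) e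
  edg (no _)     (yes refl) ne = subst (E u) (sym gu) (E-sym e)
  edg (no z≢v)   (no z≢u)   ne = subst (E _) (sym (gz z≢v z≢u)) (edges m (ne ∘ trans (gz z≢v z≢u)))
  sub : ∀ {z} → Dec (z ≡ v) → Dec (z ≡ u) → g z ≡ z → f z ≡ z
  sub (yes refl) _          _  = fv
  sub (no _)     (yes refl) _  = fu
  sub (no z≢v)   (no z≢u)   eq = trans (sym (gz z≢v z≢u)) eq

-- Gallai's lemma

module Gallai {E : Fin n → Fin n → Set} (E-sym : ∀ {y z} → E y z → E z y) (E-irrefl : ∀ {z} → ¬ E z z)
              (k : ℕ) (minimum : ∀ {g} → Matching E g → k ≤ # (fixed? g))
              (missable : ∀ {y z} → E y z → ∃ λ g → Matching E g × # (fixed? g) ≤ k × g z ≡ z) where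

  not-adjacent : ∀ {f} → Matching E f → # (fixed? f) ≤ k → ∀ {v u} → f v ≡ v → f u ≡ u → ¬ E v u
  not-adjacent m le fv fu e
    with g , mg , lt ← augment E-sym m fv fu (λ { refl → E-irrefl e }) e
    = <-irrefl refl (<-≤-trans lt (≤-trans le (minimum mg)))

  -- By `minimum`, having at most `k` fixed points means being maximum. Induction on the walk: a
  -- maximum matching that misses the neighbour `t` of `u` cannot miss `u`, which is adjacent to
  -- `t`, nor `w`, by the induction hypothesis. It is then compared with `f`, which misses both.
  missed-unique : ∀ {u w} → Star E u w → ∀ {f} → Matching E f → # (fixed? f) ≤ k →
                  f u ≡ u → f w ≡ w → u ≡ w
  missed-unique ε _ _ _ _ = refl
  missed-unique {u} {w} (_◅_ {j = t} e p) {f} m le fu fw with missable e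
  ... | g , mg , gle , gt = decidable-stable (u ≟ w) λ u≢w → descend u≢w (# (differ? g f)) mg gle gt ≤-refl
    where
    module _ (u≢w : u ≢ w) where
      ft≢t : f t ≢ t
      ft≢t ft = not-adjacent m le fu ft e

      -- Every matching g that misses t can be rotated towards f while it
      -- keeps missing t.
      descend : ∀ d {g} → Matching E g → # (fixed? g) ≤ k → g t ≡ t → # (differ? g f) ≤ d → ⊥
      descend d {g} mg gle gt dle with any? (λ y → (¬? (y ≟ t) ×-dec fixed? g y) ×-dec ¬? (fixed? f y))
      -- Apart from `t`, all vertices missed by `g` are now missed by `f`, which misses `u` and `w`
      -- besides. So `f` misses more vertices than `g`, although both are maximum.
      ... | no none = <-irrefl refl (≤-trans few gle)
        where
        other? : ∀ y → Dec (g y ≡ y × y ≢ t)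
        other? y = fixed? g y ×-dec ¬? (y ≟ t)
        still : ∀ {y} → g y ≡ y × y ≢ t → f y ≡ y
        still {y} (gy , y≢t) with f y ≟ y
        ... | yes fy = fy
        ... | no fy  = contradiction (y , (y≢t , gy) , fy) none
        few : suc k ≤ # (fixed? g)
        few = ≤-trans (s≤s (minimum mg)) (≤-trans
          (s≤s (#-insert (fixed? g) other? t (λ {y} gy → split y gy)))
          (≤-trans (#-remove₂ other? (fixed? f) {u} {w} still
            (λ (gu , _) → not-adjacent mg gle gu gt e) fu
            (λ (gw , _) → ft≢t (subst (λ z → f z ≡ z) (sym (missed-unique p mg gle gt gw)) fw)) fw u≢w)
            (≤-trans le (minimum mg))))
          where
          split : ∀ y → g y ≡ y → t ≡ y ⊎ (g y ≡ y × y ≢ t)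
          split y gy with y ≟ t
          ... | yes eq = inj₁ (sym eq)
          ... | no y≢t = inj₂ (gy , y≢t)
      ... | yes (y , (y≢t , gy) , fy≢y) = recurse d dle
        where
        e′ : E y (f y)
        e′ = edges m fy≢y
        gfy≢fy : g (f y) ≢ f y
        gfy≢fy eq = not-adjacent mg gle gy eq e′
        open Rotate mg gy refl (gfy≢fy ∘ sym)
        gt′ : conjugate y (g (f y)) g t ≡ t
        gt′ = trans (elsewhere (y≢t ∘ sym) t≢gfy t≢fy) gt
          where
          t≢fy : t ≢ f y
          t≢fy eq = gfy≢fy (trans (cong g (sym eq)) (trans gt eq))
          t≢gfy : t ≢ g (f y)
          t≢gfy eq = t≢fy (trans (sym gt) (trans (cong g eq) (involutive mg (f y))))
        recurse : ∀ d → # (differ? g f) ≤ d → ⊥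
        recurse d dle = contradiction (≤-trans (closer mg m gy fy≢y gfy≢fy) dle) (small d)
          where
          small : ∀ d → ¬ 2 + # (differ? (conjugate y (g (f y)) g) f) ≤ d
          small (suc d) (s≤s dle′) = descend d (rotated E-sym e′)
            (≤-trans (≤-reflexive (#-fixed-conjugate y (g (f y)) g)) gle) gt′ (≤-trans (n≤1+n _) dle′)

-- Rotations of a maximum matching

transpose-preserves : (S : Fin n → Set) {v w : Fin n} → S v → S w → ∀ {z} → S z → S (transpose v w z)
transpose-preserves S {v} {w} Sv Sw {z} Sz = by-cases (z ≟ v) (z ≟ w)
  where
  by-cases : Dec (z ≡ v) → Dec (z ≡ w) → S (transpose v w z)
  by-cases (yes refl) _          = subst S (sym (transpose-left v w)) Sw
  by-cases (no _)     (yes refl) = subst S (sym (transpose-right v w)) Sv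
  by-cases (no z≢v)   (no z≢w)   = subst S (sym (transpose-other v w z≢v z≢w)) Sz

module Restrict (G : Graph n) {S : Fin n → Set} (S? : ∀ z → Dec (S z)) where

  Inside : Fin n → Fin n → Set
  Inside u v = Adj G u v × S u × S v

  inside-sym : ∀ {u v} → Inside u v → Inside v u
  inside-sym (a , Su , Sv) = adj-sym G a , Sv , Su

  -- Vertices outside `S` become fixed points. This shifts every count of missed vertices of G[S] by
  -- the same amount, so comparisons between matchings of G[S] are unaffected.
  restrict : (Fin n → Fin n) → Fin n → Fin n
  restrict f z with S? z ×-dec S? (f z)
  ... | yes _ = f z
  ... | no _  = z

  restrict-in : ∀ f {z} → S z → S (f z) → restrict f z ≡ f z
  restrict-in f {z} Sz Sfz with S? z ×-dec S? (f z)
  ... | yes _ = refl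
  ... | no ¬p = contradiction (Sz , Sfz) ¬p

  restrict-out : ∀ f {z} → ¬ (S z × S (f z)) → restrict f z ≡ z
  restrict-out f {z} out with S? z ×-dec S? (f z)
  ... | yes p = contradiction p out
  ... | no _  = refl

  restrict-fixed : ∀ f {z} → f z ≡ z → restrict f z ≡ z
  restrict-fixed f {z} eq with S? z ×-dec S? (f z)
  ... | yes _ = eq
  ... | no _  = refl

  restrict-matching : ∀ {f} → Matching (Adj G) f → Matching Inside (restrict f)
  restrict-matching {f} m = record { involutive = inv ; edges = λ {z} → edg z }
    where
    inv : ∀ z → restrict f (restrict f z) ≡ z
    inv z with S? z ×-dec S? (f z)
    ... | yes (Sz , Sfz) = trans (restrict-in f Sfz (subst S (sym (involutive m z)) Sz)) (involutive m z)
    ... | no out = restrict-out f out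
    edg : ∀ z → restrict f z ≢ z → Inside z (restrict f z)
    edg z ne with S? z ×-dec S? (f z)
    ... | yes (Sz , Sfz) = edges m ne , Sz , Sfz
    ... | no _ = contradiction refl ne

  restrict-conjugate : ∀ {v w} f {f′} → S v → S w → f′ ≗ conjugate v w f →
                       restrict f′ ≗ conjugate v w (restrict f)
  restrict-conjugate {v} {w} f {f′} Sv Sw eq z = by-cases (S? (τ z) ×-dec S? (f (τ z)))
    where
    τ : Fin n → Fin n
    τ = transpose v w
    back : ∀ {y} → S (τ y) → S y
    back {y} p = subst S (transpose-involutive v w y) (transpose-preserves S Sv Sw p)
    by-cases : Dec (S (τ z) × S (f (τ z))) → restrict f′ z ≡ conjugate v w (restrict f) z
    by-cases (yes (p , q)) = trans
      (restrict-in f′ (back p) (subst S (sym (eq z)) (transpose-preserves S Sv Sw q)))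
      (trans (eq z) (cong τ (sym (restrict-in f p q))))
    by-cases (no out) = trans
      (restrict-out f′ λ (p , q) → out (transpose-preserves S Sv Sw p , back (subst S (eq z) q)))
      (sym (trans (cong τ (restrict-out f out)) (transpose-involutive v w z)))

module Rotations (G : Graph n) {μ : Fin n → Fin n} (mμ : Matching (Adj G) μ)
                 (maximum : ∀ {f} → Matching (Adj G) f → # (fixed? μ) ≤ # (fixed? f))
                 {x : Fin n} (μx : μ x ≡ x) where

  State : Set
  State = (Fin n → Fin n) × Fin n

  -- The new matching is prescribed only pointwise, so that a step can be reversed: conjugating
  -- twice returns the old matching up to pointwise equality.
  record Step (σ σ′ : State) : Set where
    constructor step
    field
      {u}  : Fin n
      adj  : Adj G (proj₂ σ) u
      fu   : proj₁ σ u ≡ proj₂ σ′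
      u≢w  : u ≢ proj₂ σ′
      f′≗  : proj₁ σ′ ≗ conjugate (proj₂ σ) (proj₂ σ′) (proj₁ σ)

  data Reach : State → Set where
    start : Reach (μ , x)
    _∷ʳ_  : ∀ {σ σ′} → Reach σ → Step σ σ′ → Reach σ′

  -- What the alternating path from `x` to `v` needs to know about a state: `f` misses `v` in place
  -- of `x` and otherwise the same vertices as `μ`. Unlike `Reach`, this does not mention the
  -- history of rotations and can be decided.
  record Exposes (f : Fin n → Fin n) (v : Fin n) : Set where
    field
      matching  : Matching (Adj G) f
      unmatched : f v ≡ v
      others    : ∀ z → f z ≡ z → z ≡ v ⊎ (μ z ≡ z × z ≢ x)
      kept      : ∀ z → μ z ≡ z → z ≢ x → f z ≡ z
      end       : μ v ≡ v → v ≡ x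

  open Exposes

  step-exposes : ∀ {f v f′ w} → Exposes f v → Step (f , v) (f′ , w) → Exposes f′ w
  step-exposes {f} {v} {f′} {w} ex (step {u} adj fu u≢w f′≗) = record
    { matching  = matching-cong (sym ∘ f′≗) (rotated (adj-sym G) adj)
    ; unmatched = trans (f′≗ w) at-w
    ; others    = λ z f′z → others′ (position z) (trans (sym (f′≗ z)) f′z)
    ; kept      = λ z μz z≢x → trans (f′≗ z) (kept′ (position z) μz z≢x)
    ; end       = λ μw → end′ μw (w ≟ x)
    }
    where
    open Rotate (matching ex) (unmatched ex) fu u≢w renaming (f′ to f⟳)
    others′ : ∀ {z} → Position z → f⟳ z ≡ z → z ≡ w ⊎ (μ z ≡ z × z ≢ x)
    others′ is-v eq = contradiction (trans (sym at-v) eq) u≢v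
    others′ is-w eq = inj₁ refl
    others′ is-u eq = contradiction (trans (sym eq) at-u) u≢v
    others′ (other {z} e) eq with others ex z (trans (sym e) eq)
    ... | inj₁ refl = contradiction (trans (sym at-v) eq) u≢v
    ... | inj₂ p    = inj₂ p
    kept′ : ∀ {z} → Position z → μ z ≡ z → z ≢ x → f⟳ z ≡ z
    kept′ is-v μz z≢x = contradiction (end ex μz) z≢x
    kept′ is-w μz z≢x = at-w
    kept′ is-u μz z≢x = contradiction (trans (sym (kept ex u μz z≢x)) fu) u≢w
    kept′ (other {z} e) μz z≢x = trans e (kept ex z μz z≢x)
    end′ : μ w ≡ w → Dec (w ≡ x) → w ≡ x
    end′ μw (yes eq)  = eq
    end′ μw (no w≢x) = contradiction (trans (sym fw) (kept ex w μw w≢x)) u≢w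

  reach-exposes : ∀ {f v} → Reach (f , v) → Exposes f v
  reach-exposes start = record
    { matching  = mμ
    ; unmatched = μx
    ; others    = λ z μz → others′ z μz (z ≟ x)
    ; kept      = λ z μz _ → μz
    ; end       = λ _ → refl
    }
    where
    others′ : ∀ z → μ z ≡ z → Dec (z ≡ x) → z ≡ x ⊎ (μ z ≡ z × z ≢ x)
    others′ z μz (yes eq) = inj₁ eq
    others′ z μz (no ne)  = inj₂ (μz , ne)
  reach-exposes (r ∷ʳ s) = step-exposes (reach-exposes r) s

  reach-size : ∀ {f v} → Reach (f , v) → # (fixed? f) ≡ # (fixed? μ)
  reach-size start = refl
  reach-size (_∷ʳ_ {σ = f , v} r s) =
    trans (#-fixed-cong (Step.f′≗ s)) (trans (#-fixed-conjugate v _ f) (reach-size r))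

  neighbour-matched : ∀ {f v} → Reach (f , v) → ∀ {u} → Adj G v u → u ≢ f u
  neighbour-matched r a eq
    with g , mg , lt ← augment (adj-sym G) (matching (reach-exposes r)) (unmatched (reach-exposes r)) (sym eq)
                         (λ { refl → adj-irrefl G a }) a
    = <-irrefl refl (<-≤-trans lt (≤-trans (≤-reflexive (reach-size r)) (maximum mg)))

  advance : ∀ {f v} → Reach (f , v) → ∀ {u} → Adj G v u → Reach (conjugate v (f u) f , f u)
  advance r a = r ∷ʳ step a refl (neighbour-matched r a) (λ _ → refl)

  -- The reverse rotation passes through the same `u`, along the former matching edge. It makes any
  -- reachable state accessible from any other by way of the start.
  step-sym : ∀ {f v σ′} → Reach (f , v) → Step (f , v) σ′ → Step σ′ (f , v)
  step-sym {f} {v} {f′ , w} r (step {u} a fu u≢w f′≗) = step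
    (adj-sym G (subst (Adj G u) fu (edges (matching (reach-exposes r)) (λ eq → u≢w (trans (sym eq) fu)))))
    (trans (f′≗ u) at-u) u≢v
    (λ z → sym (trans (cong (transpose w v) (f′≗ (transpose w v z)))
               (trans (transpose-inverse w v) (cong f (transpose-inverse v w)))))
    where open Rotate (matching (reach-exposes r)) (unmatched (reach-exposes r)) fu u≢w

  ⟶start : ∀ {σ} → Reach σ → Star Step σ (μ , x)
  ⟶start start    = ε
  ⟶start (r ∷ʳ s) = step-sym r s ◅ ⟶start r

  start⟶ : ∀ {σ} → Reach σ → Star Step (μ , x) σ
  start⟶ start    = ε
  start⟶ (r ∷ʳ s) = start⟶ r ◅◅ (s ◅ ε)

  Reachable : Fin n → Set
  Reachable v = ∃ λ f → Reach (f , v)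

  module _ (S? : ∀ v → Dec (Reachable v)) where
    open Restrict G S?

    private
      S : Fin n → Set
      S = Reachable

    -- A rotation changes partners only at `v` and `w`, which lie in `S`, and at the vertex it
    -- passes through. When a vertex outside `S` is passed for the first time, its partner is still
    -- the one under `μ`, and that partner becomes exposed.
    boundary : ∀ {f v} → Reach (f , v) → ∀ {u} → ¬ S u → f u ≡ μ u ⊎ S (μ u)
    boundary start ¬Su = inj₁ refl
    boundary {f′} {w} (_∷ʳ_ {σ = f , v} r s@(step {u₀} adj fu u≢w f′≗)) {u} ¬Su with boundary r ¬Su
    ... | inj₂ Sμu = inj₂ Sμu
    ... | inj₁ fu≡μu = by-cases (position u)
      where
      open Rotate (matching (reach-exposes r)) (unmatched (reach-exposes r)) fu u≢w renaming (f′ to f⟳)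
      by-cases : Position u → f′ u ≡ μ u ⊎ S (μ u)
      by-cases is-v = contradiction (f , r) ¬Su
      by-cases is-w = contradiction (f′ , (r ∷ʳ s)) ¬Su
      by-cases is-u = inj₂ (subst S (trans (sym fu) fu≡μu) (f′ , (r ∷ʳ s)))
      by-cases (other e) = inj₁ (trans (f′≗ u) (trans e fu≡μu))

    partner-reachable : ∀ {v u} → S v → Adj G v u → ¬ S u → S (μ u)
    partner-reachable {v} {u} (f , r) a ¬Su with boundary r ¬Su
    ... | inj₂ Sμu = Sμu
    ... | inj₁ eq  = subst S eq (_ , advance r a)

    step-restrict : ∀ {f v f′ w} → Reach (f , v) → Step (f , v) (f′ , w) →
                    restrict f′ ≗ conjugate v w (restrict f)
    step-restrict {f} r s = restrict-conjugate f (_ , r) (_ , (r ∷ʳ s)) (Step.f′≗ s)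

    step-size : ∀ {f v f′ w} → Reach (f , v) → Step (f , v) (f′ , w) →
                # (fixed? (restrict f′)) ≡ # (fixed? (restrict f))
    step-size {f} {v} {w = w} r s = trans (#-fixed-cong (step-restrict r s)) (#-fixed-conjugate v w (restrict f))

    restrict-size : ∀ {f v} → Reach (f , v) → # (fixed? (restrict f)) ≡ # (fixed? (restrict μ))
    restrict-size start    = refl
    restrict-size (r ∷ʳ s) = trans (step-size r s) (restrict-size r)

    reach-restrict : ∀ {f v} → Reach (f , v) → Matching Inside (restrict f) × restrict f v ≡ v
    reach-restrict {f} r = restrict-matching (matching (reach-exposes r)) , restrict-fixed f (unmatched (reach-exposes r))

    differ-mono : ∀ {f f′ g : Fin n → Fin n} → f′ ≗ f → # (differ? f′ g) ≤ # (differ? f g)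
    differ-mono {f} {f′} {g} eq = #-mono (differ? f′ g) (differ? f g) (λ {z} ne e → ne (trans (eq z) e))

    -- A smaller g would leave some root z of f matched.  Moving the unmatched
    -- vertex of f to z, and g along with it where they agree, never increases
    -- their difference; but as soon as g matches that vertex, they can be
    -- brought closer.
    mutual

      no-smaller : ∀ d {f v} → Reach (f , v) → ∀ {g} → Matching Inside g →
                   # (fixed? g) < # (fixed? (restrict f)) → # (differ? (restrict f) g) ≤ d → ⊥
      no-smaller d {f} r {g} mg lt le with any? (λ z → fixed? (restrict f) z ×-dec ¬? (fixed? g z))
      ... | no none = <-irrefl refl (<-≤-trans lt (#-mono (fixed? (restrict f)) (fixed? g) still))
        where
        still : ∀ {z} → restrict f z ≡ z → g z ≡ z
        still {z} fz with g z ≟ z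
        ... | yes gz = gz
        ... | no ¬gz = contradiction (z , fz , ¬gz) none
      -- As `g` matches `z` by an edge inside `S`, some reachable state exposes `z`; the chase
      -- follows the rotations leading there.
      ... | yes (z , fz , gz≢z) with _ , (h , r′) , _ ← edges mg gz≢z =
        chase d (⟶start r ◅◅ start⟶ r′) r mg lt le fz gz≢z

      chase : ∀ d {f v h z} → Star Step (f , v) (h , z) → Reach (f , v) → ∀ {g} → Matching Inside g →
              # (fixed? g) < # (fixed? (restrict f)) → # (differ? (restrict f) g) ≤ d →
              restrict f z ≡ z → g z ≢ z → ⊥
      chase d ε r mg lt le fz gz≢z = approach d r mg lt (m≤n⇒m≤1+n le) gz≢z
      chase d {f} {v} {z = z} (_◅_ {j = f′ , w} s@(step {u} a fu u≢w f′≗) p) r {g} mg lt le fz gz≢z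
        with g v ≟ v | S? u
      ... | no gv≢v | _ = approach d r mg lt (m≤n⇒m≤1+n le) gv≢v
      -- A rotation through a vertex outside `S` leaves the restriction as it is: both `v` and `w`
      -- are unmatched inside `S`, before and after.
      ... | yes gv | no ¬Su = chase d p (r ∷ʳ s) mg
          (subst (# (fixed? g) <_) (sym (step-size r s)) lt)
          (≤-trans (differ-mono same) le) (trans (same z) fz) gz≢z
        where
        r₀ = reach-restrict r
        open Rotate (matching (reach-exposes r)) (unmatched (reach-exposes r)) fu u≢w using (fw)
        restrict-w : restrict f w ≡ w
        restrict-w = restrict-out f (λ (_ , Sfw) → ¬Su (subst S fw Sfw))
        unmoved : ∀ y → Dec (y ≡ v) → Dec (y ≡ w) → conjugate v w (restrict f) y ≡ restrict f y
        unmoved y (yes refl) _ = trans (cong (transpose v w ∘ restrict f) (transpose-left v w))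
          (trans (cong (transpose v w) restrict-w) (trans (transpose-right v w) (sym (proj₂ r₀))))
        unmoved y (no _) (yes refl) = trans (cong (transpose v w ∘ restrict f) (transpose-right v w))
          (trans (cong (transpose v w) (proj₂ r₀)) (trans (transpose-left v w) (sym restrict-w)))
        unmoved y (no y≢v) (no y≢w) = trans (cong (transpose v w ∘ restrict f) (transpose-other v w y≢v y≢w))
          (transpose-other v w
            (λ eq → y≢v (injective (proj₁ r₀) (trans eq (sym (proj₂ r₀)))))
            (λ eq → y≢w (injective (proj₁ r₀) (trans eq (sym restrict-w)))))
        same : restrict f′ ≗ restrict f
        same y = trans (step-restrict r s y) (unmoved y (y ≟ v) (y ≟ w))
      ... | yes gv | yes Su = follow (g u ≟ w) (g w ≟ w)
        where
        r₀ = reach-restrict r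
        Sw : S w
        Sw = f′ , (r ∷ʳ s)
        restrict-u : restrict f u ≡ w
        restrict-u = trans (restrict-in f Su (subst S (sym fu) Sw)) fu
        open Rotate (proj₁ r₀) (proj₂ r₀) restrict-u u≢w renaming (f′ to f⟳)
        z≢v : z ≢ v
        z≢v refl = gz≢z gv
        z≢w : z ≢ w
        z≢w refl = u≢w (trans (sym fw) fz)
        z≢u : z ≢ u
        z≢u refl = u≢w (trans (sym fz) restrict-u)
        f′z : restrict f′ z ≡ z
        f′z = trans (step-restrict r s z) (trans (elsewhere z≢v z≢w z≢u) fz)
        lt′ : # (fixed? g) < # (fixed? (restrict f′))
        lt′ = subst (# (fixed? g) <_) (sym (step-size r s)) lt
        disagree : g u ≢ w → ∀ {y} → Position y → f⟳ y ≢ g y → v ≡ y ⊎ restrict f y ≢ g y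
        disagree gu≢w is-v      ne = inj₁ refl
        disagree gu≢w is-w      ne = inj₂ (λ eq → gu≢w (trans (cong g (trans (sym fw) eq)) (involutive mg w)))
        disagree gu≢w is-u      ne = inj₂ (λ eq → gu≢w (trans (sym eq) restrict-u))
        disagree gu≢w (other e) ne = inj₂ (ne ∘ trans e)
        follow : Dec (g u ≡ w) → Dec (g w ≡ w) → ⊥
        follow (yes gu) _ = chase d p (r ∷ʳ s) (Rotate.rotated mg gv gu u≢w inside-sym (a , (_ , r) , Su))
          (subst (_< # (fixed? (restrict f′))) (sym (#-fixed-conjugate v w g)) lt′)
          (≤-trans (differ-mono (step-restrict r s)) (≤-trans (#-differ-conjugate v w (restrict f) g) le))
          f′z
          (λ eq → gz≢z (trans (cong g (sym (transpose-other v w z≢v z≢w)))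
                         (trans (conjugate-fixed v w g eq) (transpose-other v w z≢v z≢w))))
        -- The rotation trades the disagreement at `w`, where both now have a fixed point, for one
        -- at `v`. At `u` they differed before.
        follow (no gu≢w) (yes gw) = chase d p (r ∷ʳ s) mg lt′
          (≤-trans (differ-mono (step-restrict r s)) (≤-trans
            (#-insert (differ? f⟳ g) rest? v (λ {y} ne → split ne (disagree gu≢w (position y) ne)))
            (≤-trans (#-remove rest? (differ? (restrict f) g) {w} proj₁ (λ (_ , w≢w) → w≢w refl)
              (λ eq → gu≢w (trans (cong g (trans (sym fw) eq)) (involutive mg w)))) le)))
          f′z gz≢z
          where
          rest? : ∀ y → Dec (restrict f y ≢ g y × y ≢ w)
          rest? y = differ? (restrict f) g y ×-dec ¬? (y ≟ w)
          split : ∀ {y} → f⟳ y ≢ g y → v ≡ y ⊎ restrict f y ≢ g y →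
                  v ≡ y ⊎ (restrict f y ≢ g y × y ≢ w)
          split ne (inj₁ eq) = inj₁ eq
          split ne (inj₂ q)  = inj₂ (q , λ { refl → ne (trans at-w (sym gw)) })
        follow (no gu≢w) (no gw≢w) = approach d (r ∷ʳ s) mg lt′
          (≤-trans (differ-mono (step-restrict r s)) (≤-trans
            (#-insert (differ? f⟳ g) (differ? (restrict f) g) v (λ {y} ne → disagree gu≢w (position y) ne))
            (s≤s le)))
          gw≢w

      -- The bound is `suc d` because the rotation that uncovers a vertex matched by `g` may add one
      -- disagreement. `closer` then removes two, so the recursion still descends.
      approach : ∀ d {f v} → Reach (f , v) → ∀ {g} → Matching Inside g →
                 # (fixed? g) < # (fixed? (restrict f)) → # (differ? (restrict f) g) ≤ suc d → g v ≢ v → ⊥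
      approach d {f} {v} r {g} mg lt le gv≢v = recurse d (≤-trans smaller le)
        where
        a : Inside v (g v)
        a = edges mg gv≢v
        s : Step (f , v) (conjugate v (f (g v)) f , f (g v))
        s = step (proj₁ a) refl (neighbour-matched r (proj₁ a)) (λ _ → refl)
        r₀ = reach-restrict r
        fgv : restrict f (g v) ≡ f (g v)
        fgv = restrict-in f (proj₂ (proj₂ a)) (_ , (r ∷ʳ s))
        smaller : 2 + # (differ? (restrict (conjugate v (f (g v)) f)) g) ≤ # (differ? (restrict f) g)
        smaller = ≤-trans
          (s≤s (s≤s (differ-mono λ y →
            trans (step-restrict r s y) (cong (λ w → conjugate v w (restrict f) y) (sym fgv)))))
          (closer (proj₁ r₀) mg (proj₂ r₀) gv≢v (λ eq → neighbour-matched r (proj₁ a) (trans (sym eq) fgv)))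
        recurse : ∀ d → 2 + # (differ? (restrict (conjugate v (f (g v)) f)) g) ≤ suc d → ⊥
        recurse (suc d) (s≤s (s≤s le′)) =
          no-smaller d (r ∷ʳ s) mg (subst (# (fixed? g) <_) (sym (step-size r s)) lt) le′

    restrict-minimum : ∀ {g} → Matching Inside g → # (fixed? (restrict μ)) ≤ # (fixed? g)
    restrict-minimum {g} mg = ≮⇒≥ λ lt → no-smaller (# (differ? (restrict μ) g)) start mg lt ≤-refl

    roots-independent : ∀ {u w} → Star Inside u w → restrict μ u ≡ u → restrict μ w ≡ w → u ≡ w
    roots-independent p = Gallai.missed-unique inside-sym (adj-irrefl G ∘ proj₁)
      (# (fixed? (restrict μ))) restrict-minimum
      (λ (_ , _ , f , r) → restrict f ,
        proj₁ (reach-restrict r) , ≤-reflexive (restrict-size r) , proj₂ (reach-restrict r))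
      p (restrict-matching mμ) ≤-refl

-- From matchings to alternating paths

alternating : ℕ → List Bool
alternating zero    = []
alternating (suc k) = false ∷ true ∷ alternating k

alternating-linked : ∀ k → Linked _≢_ (alternating k)
alternating-linked zero          = []
alternating-linked (suc zero)    = (λ ()) ∷ [-]
alternating-linked (suc (suc k)) = (λ ()) ∷ (λ ()) ∷ alternating-linked (suc k)

alternating-last : ∀ k → last (alternating (suc k)) ≡ just true
alternating-last zero    = refl
alternating-last (suc k) = alternating-last k

alternating-length : ∀ k → length (alternating k) ≡ k * 2
alternating-length zero    = refl
alternating-length (suc k) = cong (2 +_) (alternating-length k)

record Encodes (M : Graph n) (μ : Fin n → Fin n) : Set where
  field
    partner : ∀ {u v} → Adj M u v → μ u ≡ v
    matched : ∀ {u} → μ u ≢ u → Adj M u (μ u)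

module _ {M : Graph n} {μ : Fin n → Fin n} (enc : Encodes M μ) where
  open Encodes enc

  -- Turns the maximality of the number of edges into the minimality of the number of fixed points.
  encodes-size : # (fixed? μ) + 2 * numEdges M ≡ n
  encodes-size = begin
    # (fixed? μ) + 2 * numEdges M                        ≡⟨ cong (# (fixed? μ) +_) (handshake M) ⟨
    # (fixed? μ) + ## (adj? M)                           ≡⟨ ∑-distrib-+ (λ u → ⟦ fixed? μ u ⟧) (λ u → # (adj? M u)) ⟨
    sum (λ u → ⟦ fixed? μ u ⟧ + # (adj? M u))            ≡⟨ sum-cong-≗ (λ u → row u (fixed? μ u)) ⟩
    sum {n} (λ _ → 1)                                    ≡⟨ sum-const n 1 ⟩
    n * 1                                                ≡⟨ *-identityʳ n ⟩
    n                                                    ∎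
    where
    open ≡-Reasoning
    row : ∀ u (d : Dec (μ u ≡ u)) → ⟦ d ⟧ + # (adj? M u) ≡ 1
    row u (yes eq) = cong suc (#-false (adj? M u) (λ v a → adj-irrefl M (subst (Adj M u) (trans (sym (partner a)) eq) a)))
    row u (no ne)  = trans
      (≤-antisym (#-mono (adj? M u) (μ u ≟_) partner) (#-mono (μ u ≟_) (adj? M u) (λ { refl → matched ne })))
      (#-singleton (μ u))

  module _ {G : Graph n} (isM : IsMatching G M) where
    open IsMatching isM

    encodes-matching : Matching (Adj G) μ
    encodes-matching = record
      { involutive = λ z → inv z (fixed? μ z)
      ; edges      = λ ne → ⊆-edges _ _ (matched ne)
      }
      where
      inv : ∀ z → Dec (μ z ≡ z) → μ (μ z) ≡ z
      inv z (yes eq) = trans (cong μ eq) eq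
      inv z (no ne)  = partner (adj-sym M (matched ne))

encode : {G M : Graph n} → IsMatching G M → ∃ λ μ → Encodes M μ
encode {n} {G} {M} isM = μ , record { partner = partner ; matched = matched }
  where
  μ : Fin n → Fin n
  μ u with any? (adj? M u)
  ... | yes (v , _) = v
  ... | no _        = u
  partner : ∀ {u v} → Adj M u v → μ u ≡ v
  partner {u} {v} a with any? (adj? M u)
  ... | yes (w , b) = IsMatching.disjoint isM u w v b a
  ... | no none     = contradiction (v , a) none
  matched : ∀ {u} → μ u ≢ u → Adj M u (μ u)
  matched {u} ne with any? (adj? M u)
  ... | yes (w , b) = b
  ... | no _        = contradiction refl ne

module _ {G : Graph n} {f : Fin n → Fin n} (m : Matching (Adj G) f) where

  matchingGraph : Graph n
  matchingGraph = record
    { adj    = λ u v → does (edge? u v)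
    ; sym    = λ u v → sym-adj u v
    ; irrefl = λ u → irrefl u (edge? u u)
    }
    where
    edge? : ∀ u v → Dec (f u ≡ v × u ≢ v)
    edge? u v = (f u ≟ v) ×-dec ¬? (u ≟ v)
    flip : ∀ {u v} → f u ≡ v × u ≢ v → f v ≡ u × v ≢ u
    flip (refl , ne) = involutive m _ , ne ∘ sym
    sym-adj : ∀ u v → does (edge? u v) ≡ does (edge? v u)
    sym-adj u v = does-⇔ (edge? u v) (edge? v u) flip flip
      where
      does-⇔ : ∀ {A B : Set} (a? : Dec A) (b? : Dec B) → (A → B) → (B → A) → does a? ≡ does b?
      does-⇔ (yes _) (yes _) _ _ = refl
      does-⇔ (yes a) (no ¬b) h _ = contradiction (h a) ¬b
      does-⇔ (no ¬a) (yes b) _ h = contradiction (h b) ¬a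
      does-⇔ (no _)  (no _)  _ _ = refl
    irrefl : ∀ u (d : Dec (f u ≡ u × u ≢ u)) → does d ≡ false
    irrefl u (yes (_ , ne)) = contradiction refl ne
    irrefl u (no _)         = refl

  private
    invert : ∀ {A : Set} (d : Dec A) → T (does d) → A
    invert (yes a) _ = a
    reflect : ∀ {A : Set} (d : Dec A) → A → T (does d)
    reflect (yes _) _ = tt
    reflect (no ¬a) a = ¬a a
    to : ∀ {u v} → Adj matchingGraph u v → f u ≡ v × u ≢ v
    to {u} {v} = invert ((f u ≟ v) ×-dec ¬? (u ≟ v))
    from : ∀ {u v} → f u ≡ v × u ≢ v → Adj matchingGraph u v
    from {u} {v} = reflect ((f u ≟ v) ×-dec ¬? (u ≟ v))

  matchingGraph-encodes : Encodes matchingGraph f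
  matchingGraph-encodes = record { partner = proj₁ ∘ to ; matched = λ ne → from (refl , ne ∘ sym) }

  matchingGraph-isMatching : IsMatching G matchingGraph
  matchingGraph-isMatching = record
    { ⊆-edges  = λ u v a → ⊆ (to a)
    ; disjoint = λ u v w a b → trans (sym (proj₁ (to a))) (proj₁ (to b))
    }
    where
    ⊆ : ∀ {u v} → f u ≡ v × u ≢ v → Adj G u v
    ⊆ (refl , ne) = edges m (ne ∘ sym)

encodes-maximum : {G M : Graph n} → IsMaximumMatching G M → ∀ {μ} → Encodes M μ →
                  ∀ {f} → Matching (Adj G) f → # (fixed? μ) ≤ # (fixed? f)
encodes-maximum {n} {G} {M} (_ , max) {μ} enc {f} m = +-cancelˡ-≤ (2 * numEdges M) _ _ (begin
  2 * numEdges M + # (fixed? μ)   ≡⟨ +-comm (2 * numEdges M) _ ⟩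
  # (fixed? μ) + 2 * numEdges M   ≡⟨ trans (encodes-size enc) (sym (encodes-size (matchingGraph-encodes {G = G} m))) ⟩
  # (fixed? f) + 2 * numEdges M′  ≤⟨ +-monoʳ-≤ (# (fixed? f)) (*-monoʳ-≤ 2 (max M′ (matchingGraph-isMatching m))) ⟩
  # (fixed? f) + 2 * numEdges M   ≡⟨ +-comm (# (fixed? f)) _ ⟩
  2 * numEdges M + # (fixed? f)   ∎)
  where
  open ≤-Reasoning
  M′ : Graph n
  M′ = matchingGraph m

module Paths {G M : Graph n} {μ : Fin n → Fin n} (mμ : Matching (Adj G) μ) (enc : Encodes M μ)
             (maximum : ∀ {f} → Matching (Adj G) f → # (fixed? μ) ≤ # (fixed? f))
             {x : Fin n} (μx : μ x ≡ x) where
  open Rotations G mμ maximum μx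
  open Encodes enc

  module _ {f : Fin n → Fin n} {v : Fin n} (exposes : Exposes f v) where
    open Exposes exposes

    -- Invariant of the path built so far, ending in `z`. Closure under `f` is open only at `z`, and
    -- no other seen vertex is sent to `z`, so `f z` is new unless `f` fixes `z`. By `z-end`, a
    -- fixed point `z` of `f` can only be `v`.
    record Trail (Seen : Fin n → Set) (z : Fin n) : Set where
      field
        x-seen : Seen x
        z-seen : Seen z
        μ-seen : ∀ {y} → Seen y → Seen (μ y)
        f-seen : ∀ {y} → Seen y → y ≢ z → Seen (f y) × f y ≢ z
        z-end  : z ≡ x ⊎ μ z ≢ z

    record Continuation (Seen : Fin n → Set) (z : Fin n) : Set where
      field
        walk       : Walk G z v
        fresh      : All (λ y → y ≡ z ⊎ ¬ Seen y) (vertices walk)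
        unique     : IsPath walk
        halfLength : ℕ
        alternates : membership M walk ≡ alternating halfLength

    -- Following f and μ alternately from x never returns to a seen vertex and
    -- can only stop at v.
    continue : ∀ k {Seen} (seen? : ∀ y → Dec (Seen y)) {z} → n ≤ k + # seen? →
               Trail Seen z → Continuation Seen z
    extend : ∀ k {Seen} (seen? : ∀ y → Dec (Seen y)) {z} → n ≤ k + # seen? →
             Trail Seen z → f z ≢ z → Continuation Seen z

    continue k seen? {z} le t with f z ≟ z
    ... | no fz≢z = extend k seen? le t fz≢z
    ... | yes fz with others z fz | Trail.z-end t
    ...   | inj₁ refl       | _         = record
      { walk = ε ; fresh = inj₁ refl ∷ [] ; unique = [] ∷ [] ; halfLength = 0 ; alternates = refl }
    ...   | inj₂ (_ , z≢x)  | inj₁ z≡x  = contradiction z≡x z≢x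
    ...   | inj₂ (μz , _)   | inj₂ μz≢z = contradiction μz μz≢z

    extend k {Seen} seen? {z} le t fz≢z = go k le
      where
      open Trail t
      a b : Fin n
      a = f z
      b = μ a
      a-new : ¬ Seen a
      a-new s = proj₂ (f-seen s fz≢z) (involutive matching z)
      b-new : ¬ Seen b
      b-new s = a-new (subst Seen (involutive mμ a) (μ-seen s))
      b≢a : b ≢ a
      -- If `μ` fixed `a`, which is not `x`, then `f` would fix it too by `kept`, although `f`
      -- matches `a` with `z`.
      b≢a eq = fz≢z (trans (sym (kept a eq (λ { refl → a-new x-seen }))) (involutive matching z))
      Seen′ : Fin n → Set
      Seen′ y = (a ≡ y ⊎ b ≡ y) ⊎ Seen y
      seen′? : ∀ y → Dec (Seen′ y)
      seen′? y = ((a ≟ y) ⊎-dec (b ≟ y)) ⊎-dec seen? y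
      trail′ : Trail Seen′ b
      trail′ = record
        { x-seen = inj₂ x-seen
        ; z-seen = inj₁ (inj₂ refl)
        ; μ-seen = λ where
            (inj₁ (inj₁ refl)) → inj₁ (inj₂ refl)
            (inj₁ (inj₂ refl)) → inj₁ (inj₁ (sym (involutive mμ a)))
            (inj₂ s)           → inj₂ (μ-seen s)
        ; f-seen = λ where
            (inj₁ (inj₁ refl)) _   → inj₂ (subst Seen (sym (involutive matching z)) z-seen) ,
                                     λ eq → b-new (subst Seen (trans (sym (involutive matching z)) eq) z-seen)
            (inj₁ (inj₂ refl)) y≢b → contradiction refl y≢b
            {y} (inj₂ s)       _   → earlier s (y ≟ z)
        ; z-end  = inj₂ (λ eq → b≢a (sym (trans (sym (involutive mμ a)) eq)))
        }
        where
        earlier : ∀ {y} → Seen y → Dec (y ≡ z) → Seen′ (f y) × f y ≢ b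
        earlier s (yes refl) = inj₁ (inj₁ refl) , b≢a ∘ sym
        earlier s (no y≢z)   = inj₂ (proj₁ (f-seen s y≢z)) , λ eq → b-new (subst Seen eq (proj₁ (f-seen s y≢z)))
      z–a : Adj M z a → ⊥
      z–a e = a-new (subst Seen (partner e) (μ-seen z-seen))
      prepend : Continuation Seen′ b → Continuation Seen z
      prepend c = record
        { walk   = edges matching fz≢z ◅ (edges mμ b≢a ◅ walk)
        ; fresh  = inj₁ refl ∷ inj₂ a-new ∷ All.map (λ where
            (inj₁ refl) → inj₂ b-new
            (inj₂ new)  → inj₂ (new ∘ inj₂)) fresh
        ; unique = ((fz≢z ∘ sym) ∷ All.map (λ where
                      (inj₁ refl) eq   → b-new (subst Seen eq z-seen)
                      (inj₂ new)  refl → new (inj₂ z-seen)) fresh)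
                 ∷ All.map (λ where
                      (inj₁ refl) eq   → b≢a (sym eq)
                      (inj₂ new)  refl → new (inj₁ (inj₁ refl))) fresh
                 ∷ unique
        ; halfLength = suc halfLength
        ; alternates = cong₂ _∷_ (not-T z–a) (cong₂ _∷_ (Equivalence.to T-≡ (matched b≢a)) alternates)
        }
        where
        open Continuation c
        not-T : ∀ {p} → (T p → ⊥) → p ≡ false
        not-T {false} _ = refl
        not-T {true}  h = ⊥-elim (h tt)
      more : suc (# seen?) ≤ # seen′?
      more = #-remove seen? seen′? inj₂ a-new (inj₁ (inj₁ refl))
      go : ∀ k → n ≤ k + # seen? → Continuation Seen z
      go zero le = contradiction (≤-trans more (≤-trans
        (≤-trans (#-mono seen′? (λ _ → yes tt) (λ _ → tt))
                 (≤-reflexive (#-true {n} (λ _ → yes tt) (λ _ → tt)))) le)) (<-irrefl refl)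
      go (suc k) le = prepend (continue k seen′?
        (≤-trans le (≤-trans (≤-reflexive (sym (+-suc k _))) (+-monoʳ-≤ k more))) trail′)

    path : Continuation (x ≡_) x
    path = continue n (x ≟_) (m≤m+n n _) record
      { x-seen = refl
      ; z-seen = refl
      ; μ-seen = λ { refl → sym μx }
      ; f-seen = λ { refl ne → contradiction refl ne }
      ; z-end  = inj₁ refl
      }

    exposes⇒∈S : v ∈S[ G , M ] x
    exposes⇒∈S with path
    ... | record { walk = ε } = inj₁ refl
    ... | record { walk = _ ◅ _ ; halfLength = zero ; alternates = () }
    ... | record { walk = w@(_ ◅ _) ; unique = u ; halfLength = suc k ; alternates = eq } = inj₂ record
      { path        = w
      ; isPath      = u
      ; alternating = subst (Linked _≢_) (sym eq) (alternating-linked (suc k))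
      ; even        = divides (suc k) (trans (cong length eq) (alternating-length (suc k)))
      ; first∉M     = cong head eq
      ; last∈M      = trans (cong last eq) (alternating-last k)
      }

  exposes-cong : ∀ {f g v} → f ≗ g → Exposes f v → Exposes g v
  exposes-cong eq ex = record
    { matching  = matching-cong eq matching
    ; unmatched = trans (sym (eq _)) unmatched
    ; others    = λ z gz → others z (trans (eq z) gz)
    ; kept      = λ z μz z≢x → trans (sym (eq z)) (kept z μz z≢x)
    ; end       = end
    }
    where open Exposes ex

  exposes? : ∀ f v → Dec (Exposes f v)
  exposes? f v = map′
    (λ (inv , edg , fv , oth , kep , en) → record
      { matching  = record { involutive = inv ; edges = λ {z} → edg z }
      ; unmatched = fv ; others = oth ; kept = kep ; end = en })
    (λ ex → let open Exposes ex in
      involutive matching , (λ _ → edges matching) , unmatched , others , kept , end)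
    (all? (λ z → f (f z) ≟ z) ×-dec
     all? (λ z → ¬? (f z ≟ z) →-dec adj? G z (f z)) ×-dec
     (f v ≟ v) ×-dec
     all? (λ z → (f z ≟ z) →-dec ((z ≟ v) ⊎-dec ((μ z ≟ z) ×-dec ¬? (z ≟ x)))) ×-dec
     all? (λ z → (μ z ≟ z) →-dec (¬? (z ≟ x) →-dec (f z ≟ z))) ×-dec
     ((μ v ≟ v) →-dec (v ≟ x)))

  -- The functions on `Fin n` are finitely many up to pointwise equality, which `Exposes` respects.
  -- This search turns the final contradiction into an actual vertex.
  exposable? : ∀ v → Dec (∃ λ f → Exposes f v)
  exposable? v = map′ (λ (i , ex) → finToFun i , ex)
    (λ (f , ex) → funToFin f , exposes-cong (λ z → sym (finToFun-funToFin f z)) ex)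
    (any? (λ i → exposes? (finToFun i) v))

-- Counting edges at the reachable vertices

module _ {G : Graph n} (planar : Planar G) {μ : Fin n → Fin n} (mμ : Matching (Adj G) μ)
         (maximum : ∀ {f} → Matching (Adj G) f → # (fixed? μ) ≤ # (fixed? f))
         {x : Fin n} (μx : μ x ≡ x) where
  open Rotations G mμ maximum μx

  module _ (S? : ∀ v → Dec (Reachable v)) (large : ∀ v → Reachable v → 6 ≤ deg G v) where
    open Restrict G S?

    private
      S A : Fin n → Set
      S = Reachable
      A u = ¬ S u × ∃ λ v → S v × Adj G v u
      A? : ∀ u → Dec (A u)
      A? u = ¬? (S? u) ×-dec any? (λ v → S? v ×-dec adj? G v u)

      inner outer : Subgraph G
      inner = record
        { E     = Inside
        ; E?    = λ u v → adj? G u v ×-dec (S? u ×-dec S? v)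
        ; E-sym = inside-sym
        ; E⊆    = proj₁
        }
      outer = record
        { E     = λ u v → Adj G u v × (S u ⊎ S v)
        ; E?    = λ u v → adj? G u v ×-dec (S? u ⊎-dec S? v)
        ; E-sym = λ where
            (a , inj₁ s) → adj-sym G a , inj₂ s
            (a , inj₂ s) → adj-sym G a , inj₁ s
        ; E⊆    = proj₁
        }
      open Subgraph inner using () renaming (E? to inner?)
      open Subgraph outer using () renaming (E to Outer; E? to outer?)

      remote? : ∀ u → Dec (¬ S u × ¬ A u)
      remote? u = ¬? (S? u) ×-dec ¬? (A? u)
      -- In `outer` the vertices outside S ∪ A are isolated, hence components of their own, and `x`
      -- stands for the at least one component inside S ∪ A.
      I? : ∀ u → Dec (x ≡ u ⊎ (¬ S u × ¬ A u))
      I? u = (x ≟ u) ⊎-dec remote? u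

    Sx : S x
    Sx = μ , start

    remote-isolated : ∀ {u w} → ¬ S u × ¬ A u → Star Outer u w → u ≡ w
    remote-isolated _           ε                      = refl
    remote-isolated (¬Su , ¬Au) ((a , inj₁ Su) ◅ _) = contradiction Su ¬Su
    remote-isolated (¬Su , ¬Au) ((a , inj₂ Sv) ◅ _) = contradiction (¬Su , _ , Sv , adj-sym G a) ¬Au

    outer-independent : Subgraph.Independent outer (λ u → x ≡ u ⊎ (¬ S u × ¬ A u))
    outer-independent (inj₂ r)    _           p = remote-isolated r p
    outer-independent _           (inj₂ r)    p = sym (remote-isolated r (Subgraph.connected-sym outer p))
    outer-independent (inj₁ refl) (inj₁ refl) p = refl

    -- Besides `x` and the partners of `A`, the fixed points of `restrict μ` include every vertex
    -- outside `S`; the three kinds are disjoint.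
    roots-≤ : suc (# A?) + # (¬? ∘ S?) ≤ # (fixed? (restrict μ))
    roots-≤ = ≤-trans (+-monoˡ-≤ (# (¬? ∘ S?)) (≤-trans
      (s≤s (#-injection A? root-≢x? μ into (λ _ _ → injective mμ)))
      (#-remove root-≢x? root? proj₁ (λ (_ , x≢x) → x≢x refl) (Sx , restrict-fixed μ μx))))
      (#-disjoint root? (¬? ∘ S?) (fixed? (restrict μ)) proj₂
        (λ ¬Su → restrict-out μ (¬Su ∘ proj₁)) (λ (Su , _) ¬Su → ¬Su Su))
      where
      root? : ∀ u → Dec (S u × restrict μ u ≡ u)
      root? u = S? u ×-dec fixed? (restrict μ) u
      root-≢x? : ∀ u → Dec ((S u × restrict μ u ≡ u) × u ≢ x)
      root-≢x? u = root? u ×-dec ¬? (u ≟ x)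
      into : ∀ {u} → A u → (S (μ u) × restrict μ (μ u) ≡ μ u) × μ u ≢ x
      into {u} (¬Su , v , Sv , a) =
        (partner-reachable S? Sv a ¬Su , restrict-out μ (λ (_ , Sμμu) → ¬Su (subst S (involutive mμ u) Sμμu))) ,
        λ μu≡x → ¬Su (subst S (injective mμ (trans μx (sym μu≡x))) Sx)

    remote-≤ : suc (# (¬? ∘ S?)) ≤ # A? + # I?
    remote-≤ = begin
      suc (# (¬? ∘ S?))             ≤⟨ s≤s (#-cover (¬? ∘ S?) A? remote? (λ {u} → split u)) ⟩
      suc (# A? + # remote?)        ≡⟨ +-suc (# A?) _ ⟨
      # A? + suc (# remote?)        ≤⟨ +-monoʳ-≤ (# A?) (#-remove remote? I? inj₂ (λ (¬Sx , _) → ¬Sx Sx) (inj₁ refl)) ⟩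
      # A? + # I?                   ∎
      where
      open ≤-Reasoning
      split : ∀ u → ¬ S u → A u ⊎ (¬ S u × ¬ A u)
      split u ¬Su with A? u
      ... | yes Au = inj₁ Au
      ... | no ¬Au = inj₂ (¬Su , ¬Au)

    -- Each ordered adjacency is counted once if its tail is in `S` and once if its tip is, hence 12
    -- = 6 + 6. With both ends in `S` it belongs to both subgraphs, with one end in `S` only to
    -- `outer`.
    degrees : 12 * # S? ≤ ## inner? + ## outer?
    degrees = begin
      12 * # S?                                                ≡⟨ *-distribʳ-+ (# S?) 6 6 ⟩
      6 * # S? + 6 * # S?                                      ≤⟨ +-mono-≤ tails (≤-trans tips (≤-reflexive (∑-comm (λ v u → ⟦ S? v ×-dec adj? G u v ⟧)))) ⟩
      ## tail? + ## tip?                                       ≡⟨ ∑-distrib-+ (λ u → # (tail? u)) _ ⟨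
      sum (λ u → # (tail? u) + # (tip? u))                     ≡⟨ sum-cong-≗ (λ u → sym (∑-distrib-+ (λ v → ⟦ tail? u v ⟧) (λ v → ⟦ tip? u v ⟧))) ⟩
      sum (λ u → sum (λ v → ⟦ tail? u v ⟧ + ⟦ tip? u v ⟧))     ≤⟨ sum-mono _ _ (λ u → sum-mono _ _ (λ v → count (adj? G u v) (S? u) (S? v))) ⟩
      sum (λ u → sum (λ v → ⟦ inner? u v ⟧ + ⟦ outer? u v ⟧))  ≡⟨ sum-cong-≗ (λ u → ∑-distrib-+ (λ v → ⟦ inner? u v ⟧) (λ v → ⟦ outer? u v ⟧)) ⟩
      sum (λ u → # (inner? u) + # (outer? u))                  ≡⟨ ∑-distrib-+ (λ u → # (inner? u)) _ ⟩
      ## inner? + ## outer?                                    ∎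
      where
      open ≤-Reasoning
      tail? : ∀ u v → Dec (S u × Adj G u v)
      tail? u v = S? u ×-dec adj? G u v
      tip? : ∀ u v → Dec (S v × Adj G u v)
      tip? u v = S? v ×-dec adj? G u v
      star : ∀ {B : Fin n → Set} (B? : ∀ v → Dec (B v)) u (d : Dec (S u)) → (∀ {v} → Adj G u v → B v) →
             6 * ⟦ d ⟧ ≤ # (λ v → d ×-dec B? v)
      star B? u (no _)   f = z≤n
      star B? u (yes Su) f = ≤-trans (large u Su) (≤-trans (≤-reflexive (deg≡# G u))
        (#-mono (adj? G u) (λ v → yes Su ×-dec B? v) (λ a → Su , f a)))
      tails : 6 * # S? ≤ ## tail?
      tails = ≤-trans (≤-reflexive (*-distribˡ-sum 6 (λ u → ⟦ S? u ⟧)))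
        (sum-mono _ _ (λ u → star (adj? G u) u (S? u) id))
      tips : 6 * # S? ≤ sum (λ v → # (λ u → S? v ×-dec adj? G u v))
      tips = ≤-trans (≤-reflexive (*-distribˡ-sum 6 (λ u → ⟦ S? u ⟧)))
        (sum-mono _ _ (λ v → star (λ u → adj? G u v) v (S? v) (adj-sym G)))
      count : ∀ {B C D : Set} (b : Dec B) (c : Dec C) (d : Dec D) →
              ⟦ c ×-dec b ⟧ + ⟦ d ×-dec b ⟧ ≤ ⟦ b ×-dec (c ×-dec d) ⟧ + ⟦ b ×-dec (c ⊎-dec d) ⟧
      count (no _)  (no _)  (no _)  = z≤n
      count (no _)  (no _)  (yes _) = z≤n
      count (no _)  (yes _) (no _)  = z≤n
      count (no _)  (yes _) (yes _) = z≤n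
      count (yes _) (no _)  (no _)  = z≤n
      count (yes _) (no _)  (yes _) = ≤-refl
      count (yes _) (yes _) (no _)  = ≤-refl
      count (yes _) (yes _) (yes _) = ≤-refl

    -- Both uses of `sparse` refer to all `n = s + c` vertices, and those outside `S` cancel against
    -- their share of the two independent sets. The surplus 12 is twice 6: once for `x` as a missed
    -- vertex besides the partners of `A`, once for `x` as the representative of S ∪ A.
    no-large-degrees : ⊥
    no-large-degrees = <-irrefl refl (<-≤-trans (m<m+n (12 * n + 6 * a) (s≤s z≤n)) (begin
      12 * n + 6 * a + 12                            ≡⟨ cong (λ n → 12 * n + 6 * a + 12) (#-complement S?) ⟨
      12 * (s + c) + 6 * a + 12                      ≡⟨ regroup₁ s c a ⟩
      12 * s + 6 * (suc a + c) + 6 * suc c           ≤⟨ +-mono-≤ (+-mono-≤ degrees (*-monoʳ-≤ 6 roots-≤)) (*-monoʳ-≤ 6 remote-≤) ⟩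
      (g + h) + 6 * i + 6 * (a + j)                  ≡⟨ regroup₂ g h i a j ⟩
      (g + 6 * i) + (h + 6 * j) + 6 * a              ≤⟨ +-monoˡ-≤ (6 * a) (+-mono-≤
                                                          (sparse planar inner (fixed? (restrict μ)) (λ μu μw p → roots-independent S? p μu μw))
                                                          (sparse planar outer I? outer-independent)) ⟩
      6 * n + 6 * n + 6 * a                          ≡⟨ cong (_+ 6 * a) (*-distribʳ-+ n 6 6) ⟨
      12 * n + 6 * a                                 ∎))
      where
      open ≤-Reasoning
      s c a g h i j : ℕ
      s = # S?
      c = # (¬? ∘ S?)
      a = # A?
      g = ## inner?
      h = ## outer?
      i = # (fixed? (restrict μ))
      j = # I?
      regroup₁ : ∀ s c a → 12 * (s + c) + 6 * a + 12 ≡ 12 * s + 6 * (suc a + c) + 6 * suc c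
      regroup₁ = solve-∀
      regroup₂ : ∀ g h i a j → (g + h) + 6 * i + 6 * (a + j) ≡ (g + 6 * i) + (h + 6 * j) + 6 * a
      regroup₂ = solve-∀

theorem4p1 : ∀ {n : ℕ} (G M : Graph n) → Planar G → IsMaximumMatching G M →
    ∀ (x : Fin n) → Unmatched M x → ∃[ v ] (v ∈S[ G , M ] x × deg G v ≤ 5)
theorem4p1 {n} G M planar max x unmatched with encode (proj₁ max)
... | μ , enc = conclude (any? (λ v → exposable? v ×-dec (deg G v ≤? 5)))
  where
  mμ : Matching (Adj G) μ
  mμ = encodes-matching enc (proj₁ max)
  μx : μ x ≡ x
  μx = decidable-stable (μ x ≟ x) (unmatched _ ∘ Encodes.matched enc)
  maximum : ∀ {f} → Matching (Adj G) f → # (fixed? μ) ≤ # (fixed? f)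
  maximum = encodes-maximum max enc
  open Rotations G mμ maximum μx
  open Paths mμ enc maximum μx
  conclude : Dec (∃ λ v → (∃ λ f → Exposes f v) × deg G v ≤ 5) → ∃[ v ] (v ∈S[ G , M ] x × deg G v ≤ 5)
  conclude (yes (v , (f , ex) , small)) = v , exposes⇒∈S ex , small
  -- The search has failed, so only a contradiction is left to prove and reachability may be taken
  -- as decidable. Reachable vertices are exposable, hence all of them have degree at least 6.
  conclude (no none) = ⊥-elim (¬¬-decidable Reachable λ S? →
    no-large-degrees planar mμ maximum μx S? λ v (f , r) →
      ≰⇒> (λ small → none (v , (f , reach-exposes r) , small)))
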